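{- For any triangle-free graph $G$ with $\Delta(G)\geq\frac25$, we have $\beta(G)\leq\frac1{50}$.
   Context: All graphs are finite and simple. For a graph $G$ with $n\geq 1$ vertices, $\Delta(G)=\max\{|N_G(v)|/n : v\in V(G)\}$ is the relative (normalized by $n$) maximum degree, where $N_G(v)$ is the set of neighbours of $v$. A half in $G$ is a function $\mu: V(G)\to[0,1]$ such that $\sum_{v\in V(G)}\mu(v)=n/2$. Put $\beta(G,\mu)=\frac1{n^2}\sum_{\{u,v\}\in E(G)}\mu(u)\mu(v)$ (each edge is counted once) and $\beta(G)=\min\{\beta(G,\mu): \mu \text{ is a half in } G\}$. -}

module Defs where

open import Algebra.Bundles.Raw using (RawMonoid)
import Algebra.Definitions.RawMonoid
open import Data.Bool.Base using (Bool; true; false; if_then_else_; _∧_)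
open import Data.Fin.Base using (Fin; zero; suc)
import Data.Fin.Properties as Fin
open import Data.Fin.Subset as Subset using (Subset)
open import Data.Integer.Base using (+_)
open import Data.List.Base as List using (List; []; _∷_; _++_; allFin)
import Data.List.Extrema
open import Data.List.Membership.Propositional using (_∈_)
open import Data.List.Membership.Propositional.Properties
  using (∈-++⁺ˡ; ∈-++⁺ʳ; ∈-map⁺; ∈-allFin; ∈-cartesianProductWith⁺; ∈-filter⁺)
import Data.List.Relation.Unary.All as All
open import Data.List.Relation.Unary.All.Properties using (all-filter)
open import Data.List.Relation.Unary.Any using (here; there)
open import Data.Nat.Base as ℕ using (ℕ; zero; suc; NonZero)
import Data.Nat.Properties as ℕ
open import Data.Product.Base using (∃; _×_; _,_; proj₁; proj₂)
open import Data.Rational hiding (NonZero)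
open import Data.Rational.Properties
open import Data.Rational.Solver using (module +-*-Solver)
open import Data.Sum.Base using (_⊎_; inj₁; inj₂)
open import Data.Vec.Base as Vec using ([]; _∷_; lookup; tabulate)
open import Data.Vec.Properties using (lookup∘tabulate)
open import Function.Base using (_∘_)
open import Level using (0ℓ)
open import Relation.Binary.Bundles using (DecTotalOrder)
open import Relation.Binary.Core using (Rel)
open import Relation.Binary.Definitions using (Symmetric; Irreflexive; Decidable)
open import Relation.Binary.PropositionalEquality
open import Relation.Nullary using (¬_; Dec; yes; no; does; contradiction)
open import Relation.Nullary.Decidable using (_×-dec_; dec-true; dec-false)

private
  module ℚ-order where
    open +-*-Solver

    diff : ∀ {p q} d → 0ℚ ≤ d → q ≡ p + d → p ≤ q
    diff {p} {q} d 0≤d eq =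
      subst₂ _≤_ (+-identityʳ p) (sym eq) (+-monoʳ-≤ p 0≤d)

    gap : ∀ {p q} → p ≤ q → 0ℚ ≤ q - p
    gap {p} {q} p≤q = subst (_≤ q - p) (+-inverseʳ p) (+-monoˡ-≤ (- p) p≤q)

    0≤+ : ∀ {p q} → 0ℚ ≤ p → 0ℚ ≤ q → 0ℚ ≤ p + q
    0≤+ {p} {q} a b = +-mono-≤ a b

    0≤* : ∀ {p q} → 0ℚ ≤ p → 0ℚ ≤ q → 0ℚ ≤ p * q
    0≤* {p} {q} a b =
      nonNegative⁻¹ (p * q)
        {{nonNeg*nonNeg⇒nonNeg p {{nonNegative a}} q {{nonNegative b}}}}

    *-mono-≤ : ∀ {a b c d} → 0ℚ ≤ c → 0ℚ ≤ b → a ≤ b → c ≤ d → a * c ≤ b * d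
    *-mono-≤ {a} {b} {c} {d} 0≤c 0≤b a≤b c≤d =
      diff (c * (b - a) + b * (d - c)) (0≤+ (0≤* 0≤c (gap a≤b)) (0≤* 0≤b (gap c≤d)))
        (solve 4 (λ a b c d → b :* d := a :* c :+ (c :* (b :- a) :+ b :* (d :- c)))
          refl a b c d)

    0<* : ∀ {p q} → 0ℚ < p → 0ℚ < q → 0ℚ < p * q
    0<* {p} {q} a b =
      positive⁻¹ (p * q) {{pos*pos⇒pos p {{positive a}} q {{positive b}}}}

    0<⊓ : ∀ p q → 0ℚ < p → 0ℚ < q → 0ℚ < p ⊓ q
    0<⊓ p q a b with ⊓-sel p q
    ... | inj₁ eq = subst (0ℚ <_) (sym eq) a
    ... | inj₂ eq = subst (0ℚ <_) (sym eq) b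

    ∣+∣ : ∀ {a b c d p q} → ∣ a - c ∣ ≤ p → ∣ b - d ∣ ≤ q → ∣ (a + b) - (c + d) ∣ ≤ p + q
    ∣+∣ {a} {b} {c} {d} {p} {q} h k = subst (λ x → ∣ x ∣ ≤ p + q) (sym eq)
      (≤-trans (∣p+q∣≤∣p∣+∣q∣ (a - c) (b - d)) (+-mono-≤ h k))
      where
      eq : (a + b) - (c + d) ≡ (a - c) + (b - d)
      eq = solve 4 (λ a b c d → (a :+ b) :- (c :+ d) := (a :- c) :+ (b :- d)) refl a b c d

    ∣*∣ : ∀ {a b c d B C p q} → 0ℚ ≤ B → 0ℚ ≤ C → ∣ a ∣ ≤ B → ∣ d ∣ ≤ C →
          ∣ b - d ∣ ≤ p → ∣ a - c ∣ ≤ q → ∣ a * b - c * d ∣ ≤ B * p + C * q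
    ∣*∣ {a} {b} {c} {d} {B} {C} {p} {q} 0≤B 0≤C aB dC h k =
      subst (λ x → ∣ x ∣ ≤ B * p + C * q) (sym eq)
        (≤-trans (∣p+q∣≤∣p∣+∣q∣ (a * (b - d)) (d * (a - c))) (+-mono-≤ l r))
      where
      eq : a * b - c * d ≡ a * (b - d) + d * (a - c)
      eq = solve 4 (λ a b c d → a :* b :- c :* d := a :* (b :- d) :+ d :* (a :- c))
             refl a b c d
      l : ∣ a * (b - d) ∣ ≤ B * p
      l = subst (_≤ B * p) (sym (∣p*q∣≡∣p∣*∣q∣ a (b - d)))
            (*-mono-≤ (0≤∣p∣ (b - d)) 0≤B aB h)
      r : ∣ d * (a - c) ∣ ≤ C * q
      r = subst (_≤ C * q) (sym (∣p*q∣≡∣p∣*∣q∣ d (a - c)))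
            (*-mono-≤ (0≤∣p∣ (a - c)) 0≤C dC k)

    ∣∣-near : ∀ {a b p} → ∣ a - b ∣ ≤ p → ∣ a ∣ ≤ p + ∣ b ∣
    ∣∣-near {a} {b} {p} h = subst (λ x → ∣ x ∣ ≤ p + ∣ b ∣)
      (solve 2 (λ a b → (a :- b) :+ b := a) refl a b)
      (≤-trans (∣p+q∣≤∣p∣+∣q∣ (a - b) b) (+-monoˡ-≤ ∣ b ∣ h))

    ½+½ : ∀ p → ½ * p + ½ * p ≡ p
    ½+½ = solve 1 (λ p → con ½ :* p :+ con ½ :* p := p) refl

    recip : ∀ p → 0ℚ < p → ∃ λ r → 0ℚ < r × p * r ≡ 1ℚ
    recip p 0<p =
      (1/ p) {{nz}} ,
      positive⁻¹ _ {{1/pos⇒pos p {{positive 0<p}}}} ,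
      *-inverseʳ p {{nz}}
      where nz = pos⇒nonZero p {{positive 0<p}}

    0<½ : 0ℚ < ½
    0<½ = positive⁻¹ ½

  open ℚ-order

-- Cauchy sequences of rationals; the equality of reals is _≃ᴿ_ below.

record ℝ : Set where
  constructor mkℝ
  field
    seq    : ℕ → ℚ
    cauchy : ∀ ε → 0ℚ < ε →
             ∃ λ N → ∀ i j → N ℕ.≤ i → N ℕ.≤ j → ∣ seq i - seq j ∣ ≤ ε

open ℝ public using (seq)

infix 4 _≤ᴿ_ _≃ᴿ_

_≤ᴿ_ : Rel ℝ 0ℓ
x ≤ᴿ y = ∀ ε → 0ℚ < ε → ∃ λ N → ∀ k → N ℕ.≤ k → seq x k ≤ seq y k + ε

_≃ᴿ_ : Rel ℝ 0ℓ
x ≃ᴿ y = x ≤ᴿ y × y ≤ᴿ x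

fromℚ : ℚ → ℝ
fromℚ q = mkℝ (λ _ → q) λ ε 0<ε →
  0 , λ _ _ _ _ → subst (λ p → ∣ p ∣ ≤ ε) (sym (+-inverseʳ q)) (<⇒≤ 0<ε)

0ᴿ 1ᴿ : ℝ
0ᴿ = fromℚ 0ℚ
1ᴿ = fromℚ 1ℚ

private
  module ℝ-closure where
    Cauchy : (ℕ → ℚ) → Set
    Cauchy s = ∀ ε → 0ℚ < ε →
               ∃ λ N → ∀ i j → N ℕ.≤ i → N ℕ.≤ j → ∣ s i - s j ∣ ≤ ε

    abstract
      +-cauchy : ∀ s t → Cauchy s → Cauchy t → Cauchy (λ k → s k + t k)
      +-cauchy s t cs ct ε 0<ε
        with cs (½ * ε) (0<* 0<½ 0<ε) | ct (½ * ε) (0<* 0<½ 0<ε)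
      ... | M , hs | N , ht = M ℕ.⊔ N , λ i j i≥ j≥ →
        subst (∣ (s i + t i) - (s j + t j) ∣ ≤_) (½+½ ε)
          (∣+∣ {s i} {t i} {s j} {t j}
            (hs i j (ℕ.m⊔n≤o⇒m≤o M N i≥) (ℕ.m⊔n≤o⇒m≤o M N j≥))
            (ht i j (ℕ.m⊔n≤o⇒n≤o M N i≥) (ℕ.m⊔n≤o⇒n≤o M N j≥)))

      bounded : ∀ s → Cauchy s →
                ∃ λ N → ∃ λ B → 0ℚ < B × (∀ k → N ℕ.≤ k → ∣ s k ∣ ≤ B)
      bounded s cs with cs 1ℚ (positive⁻¹ 1ℚ)
      ... | N , h = N , 1ℚ + ∣ s N ∣ ,
        +-mono-<-≤ (positive⁻¹ 1ℚ) (0≤∣p∣ (s N)) ,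
        λ k k≥ → ∣∣-near {s k} {s N} (h k N k≥ ℕ.≤-refl)

      *-cauchy : ∀ s t → Cauchy s → Cauchy t → Cauchy (λ k → s k * t k)
      *-cauchy s t cs ct ε 0<ε = step (bounded s cs) (bounded t ct)
        where
        Bounded : (ℕ → ℚ) → Set
        Bounded r = ∃ λ N → ∃ λ B → 0ℚ < B × (∀ k → N ℕ.≤ k → ∣ r k ∣ ≤ B)
        0<½ε : 0ℚ < ½ * ε
        0<½ε = 0<* 0<½ 0<ε
        cancel : ∀ p q → p * q ≡ 1ℚ → p * (q * (½ * ε)) ≡ ½ * ε
        cancel p q pq≡1 = trans (sym (*-assoc p q (½ * ε)))
          (trans (cong (_* (½ * ε)) pq≡1) (*-identityˡ (½ * ε)))
        step : Bounded s → Bounded t →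
               ∃ λ N → ∀ i j → N ℕ.≤ i → N ℕ.≤ j → ∣ s i * t i - s j * t j ∣ ≤ ε
        step (K , B , 0<B , hB) (L , C , 0<C , hC) = step′ (recip B 0<B) (recip C 0<C)
          where
          step′ : (∃ λ r → 0ℚ < r × B * r ≡ 1ℚ) → (∃ λ r → 0ℚ < r × C * r ≡ 1ℚ) →
                  ∃ λ N → ∀ i j → N ℕ.≤ i → N ℕ.≤ j → ∣ s i * t i - s j * t j ∣ ≤ ε
          step′ (b , 0<b , Bb≡1) (c , 0<c , Cc≡1) =
            step″ (cs (c * (½ * ε)) (0<* 0<c 0<½ε)) (ct (b * (½ * ε)) (0<* 0<b 0<½ε))
            where
            total : B * (b * (½ * ε)) + C * (c * (½ * ε)) ≡ ε
            total = trans (cong₂ _+_ (cancel B b Bb≡1) (cancel C c Cc≡1)) (½+½ ε)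
            step″ :
              (∃ λ N → ∀ i j → N ℕ.≤ i → N ℕ.≤ j → ∣ s i - s j ∣ ≤ c * (½ * ε)) →
              (∃ λ N → ∀ i j → N ℕ.≤ i → N ℕ.≤ j → ∣ t i - t j ∣ ≤ b * (½ * ε)) →
              ∃ λ N → ∀ i j → N ℕ.≤ i → N ℕ.≤ j → ∣ s i * t i - s j * t j ∣ ≤ ε
            step″ (M , hs) (N , ht) = (K ℕ.⊔ L) ℕ.⊔ (M ℕ.⊔ N) , λ i j i≥ j≥ →
              let i≥KL = ℕ.m⊔n≤o⇒m≤o (K ℕ.⊔ L) (M ℕ.⊔ N) i≥
                  i≥MN = ℕ.m⊔n≤o⇒n≤o (K ℕ.⊔ L) (M ℕ.⊔ N) i≥
                  j≥KL = ℕ.m⊔n≤o⇒m≤o (K ℕ.⊔ L) (M ℕ.⊔ N) j≥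
                  j≥MN = ℕ.m⊔n≤o⇒n≤o (K ℕ.⊔ L) (M ℕ.⊔ N) j≥
              in subst (∣ s i * t i - s j * t j ∣ ≤_) total
                   (∣*∣ {s i} {t i} {s j} {t j} {B} {C} {b * (½ * ε)} {c * (½ * ε)}
                     (<⇒≤ 0<B) (<⇒≤ 0<C)
                     (hB i (ℕ.m⊔n≤o⇒m≤o K L i≥KL))
                     (hC j (ℕ.m⊔n≤o⇒n≤o K L j≥KL))
                     (ht i j (ℕ.m⊔n≤o⇒n≤o M N i≥MN) (ℕ.m⊔n≤o⇒n≤o M N j≥MN))
                     (hs i j (ℕ.m⊔n≤o⇒m≤o M N i≥MN) (ℕ.m⊔n≤o⇒m≤o M N j≥MN)))

infixl 6 _+ᴿ_
infixl 7 _*ᴿ_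

_+ᴿ_ : ℝ → ℝ → ℝ
mkℝ s cs +ᴿ mkℝ t ct = mkℝ (λ k → s k + t k) (ℝ-closure.+-cauchy s t cs ct)

_*ᴿ_ : ℝ → ℝ → ℝ
mkℝ s cs *ᴿ mkℝ t ct = mkℝ (λ k → s k * t k) (ℝ-closure.*-cauchy s t cs ct)

+-0-rawMonoidᴿ : RawMonoid 0ℓ 0ℓ
+-0-rawMonoidᴿ = record { _≈_ = _≃ᴿ_ ; _∙_ = _+ᴿ_ ; ε = 0ᴿ }

open Algebra.Definitions.RawMonoid +-0-rawMonoidᴿ public
  using () renaming (sum to sumᴿ)

record Graph (n : ℕ) : Set₁ where
  infix 4 _~_ _~?_
  field
    _~_    : Rel (Fin n) 0ℓ
    _~?_   : Decidable _~_
    ~-sym  : Symmetric _~_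
    ~-irr  : Irreflexive _≡_ _~_

  neighbours : Fin n → Subset n
  neighbours v = tabulate λ u → does (v ~? u)

TriangleFree : ∀ {n} → Graph n → Set
TriangleFree G = ∀ u v w → u ~ v → v ~ w → ¬ (u ~ w)
  where open Graph G

-- All the relative degrees are non-negative and there is at least one of
-- them, so the base value 0 does not affect the maximum.

Δ : ∀ {n} .{{_ : NonZero n}} → Graph n → ℚ
Δ {n} G = max 0ℚ (List.map (λ v → + Subset.∣ neighbours v ∣ / n) (allFin n))
  where
  open Graph G
  open Data.List.Extrema (DecTotalOrder.totalOrder ≤-decTotalOrder) using (max)

record IsHalf {n} (μ : Fin n → ℝ) : Set where
  field
    nonneg : ∀ v → 0ᴿ ≤ᴿ μ v
    ≤-one  : ∀ v → μ v ≤ᴿ 1ᴿ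
    total  : sumᴿ μ ≃ᴿ fromℚ (+ n / 2)

1/n² : ∀ n .{{_ : NonZero n}} → ℚ
1/n² n = (+ 1 / (n ℕ.* n)) {{ℕ.m*n≢0 n n}}

-- An edge {u , v} is counted once, at its ordering with u < v.

edgeWeight : ∀ {n} → Graph n → (Fin n → ℝ) → Fin n → Fin n → ℝ
edgeWeight G μ u v =
  if does (u Fin.<? v) ∧ does (u ~? v) then μ u *ᴿ μ v else 0ᴿ
  where open Graph G

β[_,_] : ∀ {n} .{{_ : NonZero n}} → Graph n → (Fin n → ℝ) → ℝ
β[_,_] {n} G μ = fromℚ (1/n² n) *ᴿ sumᴿ λ u → sumᴿ λ v → edgeWeight G μ u v

record IsMinimum {n} .{{_ : NonZero n}} (G : Graph n) (b : ℝ) : Set where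
  field
    attained   : ∃ λ μ → IsHalf μ × β[ G , μ ] ≃ᴿ b
    lowerBound : ∀ μ → IsHalf μ → b ≤ᴿ β[ G , μ ]

-- The minimum exists: β is the quadratic form of a graph without loops,
-- hence concave along the differences of two unit vectors.  So some half
-- with rational values, at most one of them outside {0 , 1}, is optimal
-- among the rational halves; real halves are then reached by density.

private
  module Sums where
    open +-*-Solver
    open import Algebra.Bundles using (CommutativeRing)
    open import Algebra.Properties.Semiring.Sum
      (CommutativeRing.semiring +-*-commutativeRing) public
      using (sum; sum-cong-≗; sum-replicate-zero; ∑-distrib-+; *-distribˡ-sum; *-distribʳ-sum)

    sum-mono : ∀ {n} (f g : Fin n → ℚ) → (∀ i → f i ≤ g i) → sum f ≤ sum g
    sum-mono {zero}  f g h = ≤-refl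
    sum-mono {suc n} f g h = +-mono-≤ (h zero) (sum-mono (f ∘ suc) (g ∘ suc) (h ∘ suc))

    sum-zero : ∀ n → sum {n} (λ _ → 0ℚ) ≡ 0ℚ
    sum-zero = sum-replicate-zero

    Σ² : ∀ {n} → (Fin n → Fin n → ℚ) → ℚ
    Σ² f = sum λ i → sum λ j → f i j

    Σ²-cong : ∀ {n} {f g : Fin n → Fin n → ℚ} → (∀ i j → f i j ≡ g i j) → Σ² f ≡ Σ² g
    Σ²-cong h = sum-cong-≗ λ i → sum-cong-≗ λ j → h i j

    Σ²-mono : ∀ {n} (f g : Fin n → Fin n → ℚ) → (∀ i j → f i j ≤ g i j) → Σ² f ≤ Σ² g
    Σ²-mono f g h =
      sum-mono (λ i → sum (f i)) (λ i → sum (g i)) λ i → sum-mono (f i) (g i) (h i)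

    Σ²-+ : ∀ {n} (f g : Fin n → Fin n → ℚ) → Σ² (λ i j → f i j + g i j) ≡ Σ² f + Σ² g
    Σ²-+ f g = trans (sum-cong-≗ λ i → ∑-distrib-+ (f i) (g i))
                     (∑-distrib-+ (λ i → sum (f i)) (λ i → sum (g i)))

    Σ²-* : ∀ {n} a (f : Fin n → Fin n → ℚ) → Σ² (λ i j → a * f i j) ≡ a * Σ² f
    Σ²-* a f = trans (sum-cong-≗ λ i → sym (*-distribˡ-sum a (f i)))
                     (sym (*-distribˡ-sum a (λ i → sum (f i))))

    Σ²-zero : ∀ n → Σ² {n} (λ _ _ → 0ℚ) ≡ 0ℚ
    Σ²-zero n = trans (sum-cong-≗ λ (_ : Fin n) → sum-zero n) (sum-zero n)

    unit : ∀ {n} → Fin n → Fin n → ℚ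
    unit u i = if does (u Fin.≟ i) then 1ℚ else 0ℚ

    unit-same : ∀ {n} (u : Fin n) → unit u u ≡ 1ℚ
    unit-same u = cong (if_then 1ℚ else 0ℚ) (dec-true (u Fin.≟ u) refl)

    unit-diff : ∀ {n} {u i : Fin n} → u ≢ i → unit u i ≡ 0ℚ
    unit-diff {u = u} {i} u≢i = cong (if_then 1ℚ else 0ℚ) (dec-false (u Fin.≟ i) u≢i)

    sum-unit : ∀ {n} (u : Fin n) → sum (unit u) ≡ 1ℚ
    sum-unit {suc n} zero    = trans (cong (_+_ 1ℚ) (sum-zero n)) refl
    sum-unit {suc n} (suc u) = trans (+-identityˡ _) (sum-unit u)

    sum-*unit : ∀ {n} (u : Fin n) t → sum (λ i → unit u i * t) ≡ t
    sum-*unit u t = trans (sym (*-distribʳ-sum t (unit u)))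
                          (trans (cong (_* t) (sum-unit u)) (*-identityˡ t))

  module Fractions where
    open import Data.Integer.Base as ℤ using ()
    import Data.Integer.Properties as ℤ
    import Data.Rational.Unnormalised.Base as ℚᵘ
    import Data.Rational.Unnormalised.Properties as ℚᵘ
    open import Data.Integer.Solver using () renaming (module +-*-Solver to ℤ-Solver)
    open Sums

    /-+ : ∀ a b d .{{_ : NonZero d}} → + a / d + + b / d ≡ + (a ℕ.+ b) / d
    /-+ a b (suc d) = toℚᵘ-injective
      (ℚᵘ.≃-trans (toℚᵘ-homo-+ (+ a / suc d) (+ b / suc d))
      (ℚᵘ.≃-trans (ℚᵘ.+-cong (toℚᵘ-fromℚᵘ (ℚᵘ.mkℚᵘ (+ a) d)) (toℚᵘ-fromℚᵘ (ℚᵘ.mkℚᵘ (+ b) d)))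
      (ℚᵘ.≃-trans eq
                  (ℚᵘ.≃-sym (toℚᵘ-fromℚᵘ (ℚᵘ.mkℚᵘ (+ (a ℕ.+ b)) d))))))
      where
      open ℤ-Solver
      eq : ℚᵘ.mkℚᵘ (+ a) d ℚᵘ.+ ℚᵘ.mkℚᵘ (+ b) d ℚᵘ.≃ ℚᵘ.mkℚᵘ (+ (a ℕ.+ b)) d
      eq = ℚᵘ.*≡* (trans
        (solve 3 (λ a b e → (a :* e :+ b :* e) :* e := (a :+ b) :* (e :* e))
          refl (+ a) (+ b) (+ suc d))
        (cong₂ ℤ._*_ (sym (ℤ.pos-+ a b)) (sym (ℤ.pos-* (suc d) (suc d)))))

    sum-1/ : ∀ n d .{{_ : NonZero d}} → sum {n} (λ _ → + 1 / d) ≡ + n / d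
    sum-1/ zero    d = sym (0/n≡0 d)
    sum-1/ (suc n) d = trans (cong (_+_ (+ 1 / d)) (sum-1/ n d)) (/-+ 1 n d)

    n/n≡1 : ∀ n .{{_ : NonZero n}} → + n / n ≡ 1ℚ
    n/n≡1 (suc n) = fromℚᵘ-cong {ℚᵘ.mkℚᵘ (+ suc n) n} {ℚᵘ.mkℚᵘ (+ 1) 0}
      (ℚᵘ.*≡* (ℤ.*-comm (+ suc n) (+ 1)))

    0≤/ : ∀ m d .{{_ : NonZero d}} → 0ℚ ≤ + m / d
    0≤/ m d = nonNegative⁻¹ (+ m / d) {{normalize-nonNeg m d}}

    1/≤1 : ∀ d .{{_ : NonZero d}} → + 1 / d ≤ 1ℚ
    1/≤1 (suc d) = diff (+ d / suc d) (0≤/ d (suc d))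
      (trans (sym (n/n≡1 (suc d))) (sym (/-+ 1 d (suc d))))

  open Sums

  record IsHalfℚ {n} (x : Fin n → ℚ) : Set where
    constructor mkHalf
    field
      lower : ∀ v → 0ℚ ≤ x v
      upper : ∀ v → x v ≤ 1ℚ
      total : sum x ≡ + n / 2

  open IsHalfℚ

  module Quadratic {n : ℕ} (c : Fin n → Fin n → ℚ)
    (c-loop : ∀ i → c i i ≡ 0ℚ) (0≤c : ∀ i j → 0ℚ ≤ c i j) (c≤1 : ∀ i j → c i j ≤ 1ℚ)
    where

    open +-*-Solver

    Q : (Fin n → ℚ) → ℚ
    Q x = Σ² λ i j → c i j * (x i * x j)

    Q-cong : ∀ {x y} → (∀ i → x i ≡ y i) → Q x ≡ Q y
    Q-cong h = Σ²-cong λ i j → cong (c i j *_) (cong₂ _*_ (h i) (h j))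

    L : (Fin n → ℚ) → (Fin n → ℚ) → ℚ
    L x d = Σ² λ i j → c i j * (x i * d j + d i * x j)

    Q-expand : ∀ x d t → Q (λ i → x i + t * d i) ≡ (Q x + t * L x d) + (t * t) * Q d
    Q-expand x d t = trans (Σ²-cong λ i j → expand (c i j) (x i) (x j) (d i) (d j))
      (trans (Σ²-+ (λ i j → q i j + t * l i j) (λ i j → (t * t) * r i j))
      (cong₂ _+_
        (trans (Σ²-+ q (λ i j → t * l i j)) (cong (_+_ (Σ² q)) (Σ²-* t l)))
        (Σ²-* (t * t) r)))
      where
      q l r : Fin n → Fin n → ℚ
      q i j = c i j * (x i * x j)
      l i j = c i j * (x i * d j + d i * x j)
      r i j = c i j * (d i * d j)
      expand : ∀ e a b f g →
        e * ((a + t * f) * (b + t * g)) ≡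
        (e * (a * b) + t * (e * (a * g + f * b))) + (t * t) * (e * (f * g))
      expand e a b f g = solve 6
        (λ t e a b f g → e :* ((a :+ t :* f) :* (b :+ t :* g)) :=
          (e :* (a :* b) :+ t :* (e :* (a :* g :+ f :* b))) :+ (t :* t) :* (e :* (f :* g)))
        refl t e a b f g

    dir : Fin n → Fin n → Fin n → ℚ
    dir u v i = unit u i - unit v i

    L-swap : ∀ x u v → L x (dir v u) ≡ - 1ℚ * L x (dir u v)
    L-swap x u v =
      trans (Σ²-cong λ i j → flip (c i j) (x i) (x j) (unit u i) (unit v i) (unit u j) (unit v j))
            (Σ²-* (- 1ℚ) (λ i j → c i j * (x i * dir u v j + dir u v i * x j)))
      where
      flip : ∀ e a b p q r s →
        e * (a * (s - r) + (q - p) * b) ≡ - 1ℚ * (e * (a * (r - s) + (p - q) * b))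
      flip = solve 7 (λ e a b p q r s →
        e :* (a :* (s :- r) :+ (q :- p) :* b) :=
        con (- 1ℚ) :* (e :* (a :* (r :- s) :+ (p :- q) :* b))) refl

    dir-u : ∀ {u v} → u ≢ v → dir u v u ≡ 1ℚ
    dir-u {u} u≢v = cong₂ _-_ (unit-same u) (unit-diff (u≢v ∘ sym))

    dir-v : ∀ {u v} → u ≢ v → dir u v v ≡ - 1ℚ
    dir-v {u} {v} u≢v = cong₂ _-_ (unit-diff u≢v) (unit-same v)

    dir-other : ∀ {u v i} → i ≢ u → i ≢ v → dir u v i ≡ 0ℚ
    dir-other i≢u i≢v = cong₂ _-_ (unit-diff (i≢u ∘ sym)) (unit-diff (i≢v ∘ sym))

    dir*dir≤0 : ∀ {u v} → u ≢ v → ∀ i j → i ≢ j → dir u v i * dir u v j ≤ 0ℚ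
    dir*dir≤0 {u} {v} u≢v i j i≢j with i Fin.≟ u | i Fin.≟ v | j Fin.≟ u | j Fin.≟ v
    ... | no i≢u | no i≢v | _ | _ = ≤-reflexive
          (trans (cong (_* dir u v j) (dir-other i≢u i≢v)) (*-zeroˡ (dir u v j)))
    ... | _ | _ | no j≢u | no j≢v = ≤-reflexive
          (trans (cong (dir u v i *_) (dir-other j≢u j≢v)) (*-zeroʳ (dir u v i)))
    ... | yes refl | _ | yes refl | _ = contradiction refl i≢j
    ... | _ | yes refl | _ | yes refl = contradiction refl i≢j
    ... | yes refl | _ | _ | yes refl =
          subst (_≤ 0ℚ) (sym (cong₂ _*_ (dir-u u≢v) (dir-v u≢v))) (nonPositive⁻¹ (- 1ℚ))
    ... | _ | yes refl | yes refl | _ =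
          subst (_≤ 0ℚ) (sym (cong₂ _*_ (dir-v u≢v) (dir-u u≢v))) (nonPositive⁻¹ (- 1ℚ))

    Q-dir≤0 : ∀ {u v} → u ≢ v → Q (dir u v) ≤ 0ℚ
    Q-dir≤0 {u} {v} u≢v = subst (Q (dir u v) ≤_) (Σ²-zero n)
      (Σ²-mono (λ i j → c i j * (dir u v i * dir u v j)) (λ _ _ → 0ℚ) term)
      where
      term : ∀ i j → c i j * (dir u v i * dir u v j) ≤ 0ℚ
      term i j with i Fin.≟ j
      ... | yes refl = ≤-reflexive
            (trans (cong (_* (dir u v i * dir u v i)) (c-loop i)) (*-zeroˡ (dir u v i * dir u v i)))
      ... | no i≢j = subst (c i j * (dir u v i * dir u v j) ≤_) (*-zeroʳ (c i j))
            (*-monoˡ-≤-nonNeg (c i j) {{nonNegative (0≤c i j)}} (dir*dir≤0 u≢v i j i≢j))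

    sum-dir : ∀ x u v t → sum (λ i → x i + t * dir u v i) ≡ sum x
    sum-dir x u v t =
      trans (∑-distrib-+ x (λ i → t * dir u v i))
      (trans (cong (_+_ (sum x)) (trans (sym (*-distribˡ-sum t (dir u v))) zero-sum))
             (+-identityʳ (sum x)))
      where
      neg-unit : ∀ i → dir u v i ≡ unit u i + - 1ℚ * unit v i
      neg-unit i = solve 2 (λ a b → a :- b := a :+ con (- 1ℚ) :* b) refl (unit u i) (unit v i)
      sum-dir0 : sum (dir u v) ≡ 0ℚ
      sum-dir0 = trans (sum-cong-≗ neg-unit)
        (trans (∑-distrib-+ (unit u) (λ i → - 1ℚ * unit v i))
        (cong₂ _+_ (sum-unit u)
          (trans (sym (*-distribˡ-sum (- 1ℚ) (unit v))) (cong (- 1ℚ *_) (sum-unit v)))))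
      zero-sum : t * sum (dir u v) ≡ 0ℚ
      zero-sum = trans (cong (t *_) sum-dir0) (*-zeroʳ t)

    Integral : ℚ → Set
    Integral q = q ≡ 0ℚ ⊎ q ≡ 1ℚ

    record Exchange (x : Fin n → ℚ) (u v : Fin n) : Set where
      field
        y        : Fin n → ℚ
        half     : IsHalfℚ y
        better   : Q y ≤ Q x
        same     : ∀ i → i ≢ u → i ≢ v → y i ≡ x i
        integral : Integral (y u) ⊎ Integral (y v)

    push : ∀ x u v → u ≢ v → IsHalfℚ x → L x (dir u v) ≤ 0ℚ → Exchange x u v
    push x u v u≢v hx L≤0 = result (≤-total (1ℚ - x u) (x v))
      where
      module _ (t : ℚ) (0≤t : 0ℚ ≤ t) (t≤1-u : t ≤ 1ℚ - x u) (t≤v : t ≤ x v) where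
        y : Fin n → ℚ
        y i = x i + t * dir u v i
        yu : y u ≡ x u + t
        yu = cong (_+_ (x u)) (trans (cong (t *_) (dir-u u≢v)) (*-identityʳ t))
        yv : y v ≡ x v - t
        yv = cong (_+_ (x v)) (trans (cong (t *_) (dir-v u≢v))
               (solve 1 (λ t → t :* con (- 1ℚ) := :- t) refl t))
        y-other : ∀ i → i ≢ u → i ≢ v → y i ≡ x i
        y-other i i≢u i≢v = trans
          (cong (_+_ (x i)) (trans (cong (t *_) (dir-other i≢u i≢v)) (*-zeroʳ t)))
          (+-identityʳ (x i))
        0≤y : ∀ i → 0ℚ ≤ y i
        0≤y i with i Fin.≟ u | i Fin.≟ v
        ... | yes refl | _ = subst (0ℚ ≤_) (sym yu) (0≤+ (lower hx u) 0≤t)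
        ... | no _ | yes refl = subst (0ℚ ≤_) (sym yv) (gap t≤v)
        ... | no i≢u | no i≢v = subst (0ℚ ≤_) (sym (y-other i i≢u i≢v)) (lower hx i)
        y≤1 : ∀ i → y i ≤ 1ℚ
        y≤1 i with i Fin.≟ u | i Fin.≟ v
        ... | yes refl | _ = subst (_≤ 1ℚ) (sym yu) (diff ((1ℚ - x u) - t) (gap t≤1-u)
                (solve 2 (λ a t → con 1ℚ := (a :+ t) :+ ((con 1ℚ :- a) :- t)) refl (x u) t))
        ... | no _ | yes refl = subst (_≤ 1ℚ) (sym yv)
                (diff ((1ℚ - x v) + t) (0≤+ (gap (upper hx v)) 0≤t)
                (solve 2 (λ a t → con 1ℚ := (a :- t) :+ ((con 1ℚ :- a) :+ t)) refl (x v) t))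
        ... | no i≢u | no i≢v = subst (_≤ 1ℚ) (sym (y-other i i≢u i≢v)) (upper hx i)
        Qy≤Qx : Q y ≤ Q x
        Qy≤Qx = diff (t * (0ℚ - L x (dir u v)) + (t * t) * (0ℚ - Q (dir u v)))
          (0≤+ (0≤* 0≤t (gap L≤0)) (0≤* (0≤* 0≤t 0≤t) (gap (Q-dir≤0 u≢v))))
          (trans (rearrange (Q x) (L x (dir u v)) (Q (dir u v)) t)
                 (cong (_+ (t * (0ℚ - L x (dir u v)) + (t * t) * (0ℚ - Q (dir u v))))
                   (sym (Q-expand x (dir u v) t))))
          where
          rearrange : ∀ q l r t →
            q ≡ ((q + t * l) + (t * t) * r) + (t * (0ℚ - l) + (t * t) * (0ℚ - r))
          rearrange = solve 4 (λ q l r t →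
            q := ((q :+ t :* l) :+ (t :* t) :* r) :+
                 (t :* (con 0ℚ :- l) :+ (t :* t) :* (con 0ℚ :- r))) refl
        exchange : Integral (y u) ⊎ Integral (y v) → Exchange x u v
        exchange int = record
          { y = y ; half = mkHalf 0≤y y≤1 (trans (sum-dir x u v t) (total hx))
          ; better = Qy≤Qx ; same = y-other ; integral = int }
      result : 1ℚ - x u ≤ x v ⊎ x v ≤ 1ℚ - x u → Exchange x u v
      result (inj₁ h) = exchange t (gap (upper hx u)) ≤-refl h
        (inj₁ (inj₂ (trans (yu t (gap (upper hx u)) ≤-refl h)
          (solve 1 (λ a → a :+ (con 1ℚ :- a) := con 1ℚ) refl (x u)))))
        where t = 1ℚ - x u
      result (inj₂ h) = exchange (x v) (lower hx v) h ≤-refl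
        (inj₂ (inj₁ (trans (yv (x v) (lower hx v) h ≤-refl) (+-inverseʳ (x v)))))

    exchange : ∀ x u v → u ≢ v → IsHalfℚ x → Exchange x u v
    exchange x u v u≢v hx = result (≤-total (L x (dir u v)) 0ℚ)
      where
      result : L x (dir u v) ≤ 0ℚ ⊎ 0ℚ ≤ L x (dir u v) → Exchange x u v
      result (inj₁ L≤0) = push x u v u≢v hx L≤0
      result (inj₂ 0≤L) = record
        { y = E.y ; half = E.half ; better = E.better
        ; same = λ i i≢u i≢v → E.same i i≢v i≢u
        ; integral = swap E.integral }
        where
        open import Data.Sum.Base using (swap)
        L′≤0 : L x (dir v u) ≤ 0ℚ
        L′≤0 = subst (_≤ 0ℚ) (sym (L-swap x u v))
          (diff (L x (dir u v)) 0≤L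
            (solve 1 (λ l → con 0ℚ := con (- 1ℚ) :* l :+ l) refl (L x (dir u v))))
        module E = Exchange (push x v u (u≢v ∘ sym) hx L′≤0)

    record Rounding (x : Fin n → ℚ) (is : List (Fin n)) : Set where
      field
        y        : Fin n → ℚ
        p        : Fin n
        half     : IsHalfℚ y
        better   : Q y ≤ Q x
        integral : ∀ i → i ∈ is → i ≢ p → Integral (y i)

    rounding : Fin n → ∀ x → IsHalfℚ x → ∀ is → Rounding x is
    rounding p₀ x hx []       = record
      { y = x ; p = p₀ ; half = hx ; better = ≤-refl ; integral = λ _ () }
    rounding p₀ x hx (i ∷ is) = result (i Fin.≟ R.p)
      where
      module R = Rounding (rounding p₀ x hx is)
      result : Dec (i ≡ R.p) → Rounding x (i ∷ is)
      result (yes i≡p) = record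
        { y = R.y ; p = R.p ; half = R.half ; better = R.better ; integral = int }
        where
        int : ∀ j → j ∈ i ∷ is → j ≢ R.p → Integral (R.y j)
        int j (here j≡i)   j≢p = contradiction (trans j≡i i≡p) j≢p
        int j (there j∈is) j≢p = R.integral j j∈is j≢p
      result (no i≢p) = choose E.integral
        where
        module E = Exchange (exchange R.y i R.p i≢p R.half)
        old : ∀ j → j ∈ is → j ≢ i → j ≢ R.p → Integral (E.y j)
        old j j∈is j≢i j≢p = subst Integral (sym (E.same j j≢i j≢p)) (R.integral j j∈is j≢p)
        choose : Integral (E.y i) ⊎ Integral (E.y R.p) → Rounding x (i ∷ is)
        choose (inj₁ int-i) = record
          { y = E.y ; p = R.p ; half = E.half ; better = ≤-trans E.better R.better
          ; integral = int }
          where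
          int : ∀ j → j ∈ i ∷ is → j ≢ R.p → Integral (E.y j)
          int j (here refl)  j≢p = int-i
          int j (there j∈is) j≢p with j Fin.≟ i
          ... | yes refl = int-i
          ... | no j≢i   = old j j∈is j≢i j≢p
        choose (inj₂ int-p) = record
          { y = E.y ; p = i ; half = E.half ; better = ≤-trans E.better R.better
          ; integral = int }
          where
          int : ∀ j → j ∈ i ∷ is → j ≢ i → Integral (E.y j)
          int j (here j≡i)   j≢i = contradiction j≡i j≢i
          int j (there j∈is) j≢i with j Fin.≟ R.p
          ... | yes refl = int-p
          ... | no j≢p   = old j j∈is j≢i j≢p

    -- The candidates for an optimal half: the indicator function of a set,
    -- corrected at one vertex p so that the total weight is n / 2.

    indicator : Subset n → Fin n → Fin n → ℚ
    indicator S p i =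
      if does (p Fin.≟ i) then 0ℚ else (if lookup S i then 1ℚ else 0ℚ)

    candidate : Subset n → Fin n → Fin n → ℚ
    candidate S p i = indicator S p i + unit p i * (+ n / 2 - sum (indicator S p))

    is-candidate : ∀ y p → IsHalfℚ y → (∀ i → i ≢ p → Integral (y i)) →
                   ∀ i → y i ≡ candidate (tabulate λ i → does (y i ≟ 1ℚ)) p i
    is-candidate y p hy int i = trans (split i) (cong (λ w → a i + unit p i * w) yp)
      where
      S : Subset n
      S = tabulate λ i → does (y i ≟ 1ℚ)
      a : Fin n → ℚ
      a = indicator S p
      value : ∀ i → Integral (y i) → y i ≡ (if does (y i ≟ 1ℚ) then 1ℚ else 0ℚ)
      value i h with y i ≟ 1ℚ | h
      ... | yes eq | _       = eq
      ... | no neq | inj₁ eq = eq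
      ... | no neq | inj₂ eq = contradiction eq neq
      split : ∀ i → y i ≡ a i + unit p i * y p
      split i with p Fin.≟ i
      ... | yes refl = sym (trans (+-identityˡ (1ℚ * y p)) (*-identityˡ (y p)))
      ... | no p≢i = trans (value i (int i (p≢i ∘ sym)))
            (trans (cong (if_then 1ℚ else 0ℚ) (sym (lookup∘tabulate (λ i → does (y i ≟ 1ℚ)) i)))
            (sym (trans (cong (_+_ s) (*-zeroˡ (y p))) (+-identityʳ s))))
            where s = if lookup S i then 1ℚ else 0ℚ
      sum-y : + n / 2 ≡ sum a + y p
      sum-y = trans (sym (total hy)) (trans (sum-cong-≗ split)
        (trans (∑-distrib-+ a (λ i → unit p i * y p)) (cong (_+_ (sum a)) (sum-*unit p (y p)))))
      yp : y p ≡ + n / 2 - sum a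
      yp = trans (solve 2 (λ s w → w := (s :+ w) :- s) refl (sum a) (y p))
                 (cong (_- sum a) (sym sum-y))

    IsHalfℚ? : (x : Fin n → ℚ) → Dec (IsHalfℚ x)
    IsHalfℚ? x = map′ {A = Conditions}
      (λ (l , u , t) → mkHalf l u t) (λ h → lower h , upper h , total h)
      (Fin.all? (λ i → 0ℚ ≤? x i) ×-dec Fin.all? (λ i → x i ≤? 1ℚ) ×-dec (sum x ≟ + n / 2))
      where
      open import Relation.Nullary.Decidable using (map′)
      Conditions : Set
      Conditions = (∀ i → 0ℚ ≤ x i) × (∀ i → x i ≤ 1ℚ) × sum x ≡ + n / 2

    subsets : ∀ m → List (Subset m)
    subsets zero    = [] ∷ []
    subsets (suc m) = List.map (true ∷_) (subsets m) ++ List.map (false ∷_) (subsets m)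

    ∈-subsets : ∀ {m} (S : Subset m) → S ∈ subsets m
    ∈-subsets []                  = here refl
    ∈-subsets {suc m} (true  ∷ S) = ∈-++⁺ˡ (∈-map⁺ (true ∷_) (∈-subsets S))
    ∈-subsets {suc m} (false ∷ S) =
      ∈-++⁺ʳ (List.map (true ∷_) (subsets m)) (∈-map⁺ (false ∷_) (∈-subsets S))

    candidates : List (Fin n → ℚ)
    candidates = List.cartesianProductWith candidate (subsets n) (allFin n)

    uniform : Fin n → ℚ
    uniform _ = ½

    uniform-half : IsHalfℚ uniform
    uniform-half = mkHalf (λ _ → nonNegative⁻¹ ½) (λ _ → ½≤1)
      (Fractions.sum-1/ n 2)
      where
      ½≤1 : ½ ≤ 1ℚ
      ½≤1 = diff ½ (nonNegative⁻¹ ½) refl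

    open Data.List.Extrema (DecTotalOrder.totalOrder ≤-decTotalOrder)
      using (argmin; argmin-all; f[argmin]≤f[xs])

    optimum : Fin n → ℚ
    optimum = argmin Q uniform (List.filter IsHalfℚ? candidates)

    optimum-half : IsHalfℚ optimum
    optimum-half = argmin-all Q uniform-half (all-filter IsHalfℚ? candidates)

    optimum-least : Fin n → ∀ x → IsHalfℚ x → Q optimum ≤ Q x
    optimum-least p₀ x hx = ≤-trans (≤-trans best (≤-reflexive (sym (Q-cong eq)))) R.better
      where
      module R = Rounding (rounding p₀ x hx (allFin n))
      z : Fin n → ℚ
      z = candidate (tabulate λ i → does (R.y i ≟ 1ℚ)) R.p
      eq : ∀ i → R.y i ≡ z i
      eq = is-candidate R.y R.p R.half λ i → R.integral i (∈-allFin i)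
      z-half : IsHalfℚ z
      z-half = mkHalf (λ i → subst (0ℚ ≤_) (eq i) (lower R.half i))
                      (λ i → subst (_≤ 1ℚ) (eq i) (upper R.half i))
                      (trans (sym (sum-cong-≗ eq)) (total R.half))
      best : Q optimum ≤ Q z
      best = All.lookup (f[argmin]≤f[xs] {f = Q} uniform (List.filter IsHalfℚ? candidates))
        (∈-filter⁺ IsHalfℚ? (∈-cartesianProductWith⁺ candidate
          (∈-subsets (tabulate λ i → does (R.y i ≟ 1ℚ))) (∈-allFin R.p)) z-half)

    -- An approximate half x is close to an honest half y, obtained by
    -- spreading its excess evenly and contracting towards the value ½.

    module Approximate (0<n : NonZero n) (x : Fin n → ℚ) (η : ℚ)
      (0≤η : 0ℚ ≤ η) (η≤¼ : 0ℚ ≤ 1ℚ - (+ 4 / 1) * η)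
      (low : ∀ i → 0ℚ ≤ x i + η) (high : ∀ i → 0ℚ ≤ (1ℚ + η) - x i)
      (sum≤ : sum x ≤ + n / 2 + η) (≤sum : + n / 2 ≤ sum x + η)
      where

      4ℚ 5ℚ 15ℚ : ℚ
      4ℚ  = + 4 / 1
      5ℚ  = + 5 / 1
      15ℚ = + 15 / 1

      w s g : ℚ
      w = (+ 1 / n) {{0<n}}
      s = sum x - + n / 2
      g = s * w

      0≤w : 0ℚ ≤ w
      0≤w = Fractions.0≤/ 1 n {{0<n}}

      0≤1-w : 0ℚ ≤ 1ℚ - w
      0≤1-w = gap (Fractions.1/≤1 n {{0<n}})

      0≤η-g : 0ℚ ≤ η - g
      0≤η-g = subst (0ℚ ≤_)
        (solve 4 (λ S h e w → w :* ((h :+ e) :- S) :+ (con 1ℚ :- w) :* e := e :- (S :- h) :* w)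
          refl (sum x) (+ n / 2) η w)
        (0≤+ (0≤* 0≤w (gap sum≤)) (0≤* 0≤1-w 0≤η))

      0≤η+g : 0ℚ ≤ η + g
      0≤η+g = subst (0ℚ ≤_)
        (solve 4 (λ S h e w → w :* ((S :+ e) :- h) :+ (con 1ℚ :- w) :* e := e :+ (S :- h) :* w)
          refl (sum x) (+ n / 2) η w)
        (0≤+ (0≤* 0≤w (gap ≤sum)) (0≤* 0≤1-w 0≤η))

      shrink : ℚ → ℚ
      shrink a = ½ + (1ℚ - 4ℚ * η) * ((a - g) - ½)

      y : Fin n → ℚ
      y i = shrink (x i)

      0≤η² : 0ℚ ≤ (+ 8 / 1) * (η * η)
      0≤η² = 0≤* (nonNegative⁻¹ (+ 8 / 1)) (0≤* 0≤η 0≤η)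

      0≤y : ∀ i → 0ℚ ≤ y i
      0≤y i = subst (0ℚ ≤_)
        (solve 3 (λ a e g →
          (con 1ℚ :- con 4ℚ :* e) :* ((a :+ e) :+ (e :- g)) :+ con (+ 8 / 1) :* (e :* e) :=
          con ½ :+ (con 1ℚ :- con 4ℚ :* e) :* ((a :- g) :- con ½)) refl (x i) η g)
        (0≤+ (0≤* η≤¼ (0≤+ (low i) 0≤η-g)) 0≤η²)

      0≤1-y : ∀ i → 0ℚ ≤ 1ℚ - y i
      0≤1-y i = subst (0ℚ ≤_)
        (solve 3 (λ a e g →
          (con 1ℚ :- con 4ℚ :* e) :* (((con 1ℚ :+ e) :- a) :+ (e :+ g)) :+
            con (+ 8 / 1) :* (e :* e) :=
          con 1ℚ :- (con ½ :+ (con 1ℚ :- con 4ℚ :* e) :* ((a :- g) :- con ½)))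
          refl (x i) η g)
        (0≤+ (0≤* η≤¼ (0≤+ (high i) 0≤η+g)) 0≤η²)

      0≤½t : 0ℚ ≤ ½ * (1ℚ - 4ℚ * η)
      0≤½t = 0≤* (nonNegative⁻¹ ½) η≤¼

      close⁺ : ∀ i → 0ℚ ≤ (x i - y i) + 5ℚ * η
      close⁺ i = subst (0ℚ ≤_)
        (solve 3 (λ a e g →
          (e :+ g) :+ (con 4ℚ :* e) :*
            (((a :+ e) :+ (e :- g)) :+ con ½ :* (con 1ℚ :- con 4ℚ :* e)) :=
          (a :- (con ½ :+ (con 1ℚ :- con 4ℚ :* e) :* ((a :- g) :- con ½))) :+ con 5ℚ :* e)
          refl (x i) η g)
        (0≤+ 0≤η+g (0≤* (0≤* (nonNegative⁻¹ 4ℚ) 0≤η) (0≤+ (0≤+ (low i) 0≤η-g) 0≤½t)))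

      close⁻ : ∀ i → 0ℚ ≤ 5ℚ * η - (x i - y i)
      close⁻ i = subst (0ℚ ≤_)
        (solve 3 (λ a e g →
          (e :- g) :+ (con 4ℚ :* e) :*
            ((((con 1ℚ :+ e) :- a) :+ (e :+ g)) :+ con ½ :* (con 1ℚ :- con 4ℚ :* e)) :=
          con 5ℚ :* e :- (a :- (con ½ :+ (con 1ℚ :- con 4ℚ :* e) :* ((a :- g) :- con ½))))
          refl (x i) η g)
        (0≤+ 0≤η-g (0≤* (0≤* (nonNegative⁻¹ 4ℚ) 0≤η) (0≤+ (0≤+ (high i) 0≤η+g) 0≤½t)))

      sum-y : sum y ≡ + n / 2
      sum-y = trans (sum-cong-≗ affine)
        (trans (∑-distrib-+ (λ i → t * x i + B * w) (λ _ → C * ½))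
        (trans (cong₂ _+_
          (trans (∑-distrib-+ (λ i → t * x i) (λ _ → B * w))
                 (cong₂ _+_ (sym (*-distribˡ-sum t x))
                   (trans (sym (*-distribˡ-sum {n} B (λ _ → w))) (cong (B *_) sum-w))))
          (trans (sym (*-distribˡ-sum {n} C (λ _ → ½))) (cong (C *_) (Fractions.sum-1/ n 2))))
        (solve 3 (λ S h e →
          ((con 1ℚ :- con 4ℚ :* e) :* S :+
            (:- ((con 1ℚ :- con 4ℚ :* e) :* (S :- h))) :* con 1ℚ) :+
            (con 4ℚ :* e) :* h := h)
          refl (sum x) (+ n / 2) η)))
        where
        t B C : ℚ
        t = 1ℚ - 4ℚ * η
        B = - (t * s)
        C = 4ℚ * η
        sum-w : sum {n} (λ _ → w) ≡ 1ℚ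
        sum-w = trans (Fractions.sum-1/ n n {{0<n}}) (Fractions.n/n≡1 n {{0<n}})
        affine : ∀ i → y i ≡ (t * x i + B * w) + C * ½
        affine i = solve 4 (λ a e s w →
          con ½ :+ (con 1ℚ :- con 4ℚ :* e) :* ((a :- s :* w) :- con ½) :=
          ((con 1ℚ :- con 4ℚ :* e) :* a :+ (:- ((con 1ℚ :- con 4ℚ :* e) :* s)) :* w) :+
            (con 4ℚ :* e) :* con ½) refl (x i) η s w

      y-half : IsHalfℚ y
      y-half = mkHalf 0≤y
        (λ i → diff (1ℚ - y i) (0≤1-y i)
          (solve 1 (λ a → con 1ℚ := a :+ (con 1ℚ :- a)) refl (y i)))
        sum-y

      product : ∀ i j → 0ℚ ≤ (x i * x j - y i * y j) + 15ℚ * η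
      product i j = subst (0ℚ ≤_)
        (identity (x i) (x j) (y i) (y j) η)
        (0≤+ (0≤+ (0≤+ (0≤* (low i) (close⁺ j)) (0≤* 0≤η (close⁻ j)))
                  (0≤* (0≤y j) (close⁺ i)))
             (0≤* (0≤* (nonNegative⁻¹ 5ℚ) 0≤η)
                  (0≤+ (0≤+ (0≤1-y j) (high i)) (0≤+ η≤¼ 0≤η))))
        where
        identity : ∀ a b p q e →
          ((((a + e) * ((b - q) + 5ℚ * e)) + e * (5ℚ * e - (b - q))) + q * ((a - p) + 5ℚ * e))
            + (5ℚ * e) * (((1ℚ - q) + ((1ℚ + e) - a)) + ((1ℚ - 4ℚ * e) + e))
          ≡ (a * b - p * q) + 15ℚ * e
        identity = solve 5 (λ a b p q e →
          ((((a :+ e) :* ((b :- q) :+ con 5ℚ :* e)) :+ e :* (con 5ℚ :* e :- (b :- q)))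
            :+ q :* ((a :- p) :+ con 5ℚ :* e))
            :+ (con 5ℚ :* e) :* (((con 1ℚ :- q) :+ ((con 1ℚ :+ e) :- a))
              :+ ((con 1ℚ :- con 4ℚ :* e) :+ e))
          := (a :* b :- p :* q) :+ con 15ℚ :* e) refl

      bound : Q y ≤ Q x + η * Σ² {n} (λ _ _ → 15ℚ)
      bound = subst (Q y ≤_)
        (trans (Σ²-+ (λ i j → c i j * (x i * x j)) (λ _ _ → η * 15ℚ))
               (cong (_+_ (Q x)) (Σ²-* {n} η (λ _ _ → 15ℚ))))
        (Σ²-mono (λ i j → c i j * (y i * y j)) (λ i j → c i j * (x i * x j) + η * 15ℚ) term)
        where
        term : ∀ i j → c i j * (y i * y j) ≤ c i j * (x i * x j) + η * 15ℚ
        term i j = diff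
          (c i j * ((x i * x j - y i * y j) + 15ℚ * η) + (1ℚ - c i j) * (15ℚ * η))
          (0≤+ (0≤* (0≤c i j) (product i j))
               (0≤* (gap (c≤1 i j)) (0≤* (nonNegative⁻¹ 15ℚ) 0≤η)))
          (solve 4 (λ c p q e →
            c :* p :+ e :* con 15ℚ :=
            c :* q :+ (c :* ((p :- q) :+ con 15ℚ :* e) :+ (con 1ℚ :- c) :* (con 15ℚ :* e)))
            refl (c i j) (x i * x j) (y i * y j) η)

  module Existence {n : ℕ} (0<n : NonZero n) (G : Graph n) where
    open Graph G

    edge : Fin n → Fin n → Bool
    edge u v = does (u Fin.<? v) ∧ does (u ~? v)

    c : Fin n → Fin n → ℚ
    c u v = if edge u v then 1ℚ else 0ℚ

    c-loop : ∀ i → c i i ≡ 0ℚ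
    c-loop i = cong (λ b → if b ∧ does (i ~? i) then 1ℚ else 0ℚ)
      (dec-false (i Fin.<? i) (Fin.<-irrefl refl))

    0≤c : ∀ i j → 0ℚ ≤ c i j
    0≤c i j with edge i j
    ... | true  = nonNegative⁻¹ 1ℚ
    ... | false = ≤-refl

    c≤1 : ∀ i j → c i j ≤ 1ℚ
    c≤1 i j with edge i j
    ... | true  = ≤-refl
    ... | false = nonNegative⁻¹ 1ℚ

    open Quadratic c c-loop 0≤c c≤1

    inv : ℚ
    inv = 1/n² n {{0<n}}

    0≤inv : 0ℚ ≤ inv
    0≤inv = Fractions.0≤/ 1 (n ℕ.* n) {{ℕ.m*n≢0 n n {{0<n}} {{0<n}}}}

    inv≤1 : inv ≤ 1ℚ
    inv≤1 = Fractions.1/≤1 (n ℕ.* n) {{ℕ.m*n≢0 n n {{0<n}} {{0<n}}}}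

    seq-sum : ∀ {m} (f : Fin m → ℝ) k → seq (sumᴿ f) k ≡ sum (λ i → seq (f i) k)
    seq-sum {zero}  f k = refl
    seq-sum {suc m} f k = cong (_+_ (seq (f zero) k)) (seq-sum (f ∘ suc) k)

    seq-β : ∀ μ k → seq (β[_,_] {{0<n}} G μ) k ≡ inv * Q (λ v → seq (μ v) k)
    seq-β μ k = cong (inv *_)
      (trans (seq-sum (λ u → sumᴿ λ v → edgeWeight G μ u v) k)
        (sum-cong-≗ λ u → trans (seq-sum (λ v → edgeWeight G μ u v) k) (sum-cong-≗ (term u))))
      where
      term : ∀ u v → seq (edgeWeight G μ u v) k ≡ c u v * (seq (μ u) k * seq (μ v) k)
      term u v with edge u v
      ... | true  = sym (*-identityˡ (seq (μ u) k * seq (μ v) k))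
      ... | false = sym (*-zeroˡ (seq (μ u) k * seq (μ v) k))

    value : ℝ
    value = fromℚ (inv * Q optimum)

    pointwise : ∀ x y → (∀ k → seq x k ≤ seq y k) → x ≤ᴿ y
    pointwise x y h ε 0<ε = 0 , λ k _ →
      diff ((seq y k - seq x k) + ε) (0≤+ (gap (h k)) (<⇒≤ 0<ε))
        (+-*-Solver.solve 3 (λ a b e → b :+ e := a :+ ((b :- a) :+ e)) refl (seq x k) (seq y k) ε)
      where open +-*-Solver using (_:+_; _:-_; _:=_)

    ν : Fin n → ℝ
    ν v = fromℚ (optimum v)

    ν-half : IsHalf ν
    ν-half = record
      { nonneg = λ v → pointwise 0ᴿ (ν v) λ _ → lower optimum-half v
      ; ≤-one  = λ v → pointwise (ν v) 1ᴿ λ _ → upper optimum-half v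
      ; total  = pointwise (sumᴿ ν) (fromℚ (+ n / 2)) (λ k → ≤-reflexive (eq k))
               , pointwise (fromℚ (+ n / 2)) (sumᴿ ν) (λ k → ≤-reflexive (sym (eq k))) }
      where
      eq : ∀ k → seq (sumᴿ ν) k ≡ + n / 2
      eq k = trans (seq-sum ν k) (total optimum-half)

    ν-value : β[_,_] {{0<n}} G ν ≃ᴿ value
    ν-value =
      pointwise (β[_,_] {{0<n}} G ν) value (λ k → ≤-reflexive (seq-β ν k)) ,
      pointwise value (β[_,_] {{0<n}} G ν) (λ k → ≤-reflexive (sym (seq-β ν k)))

    Eventually : (ℕ → Set) → Set
    Eventually P = ∃ λ N → ∀ k → N ℕ.≤ k → P k

    both : ∀ {P R} → Eventually P → Eventually R → Eventually (λ k → P k × R k)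
    both (M , p) (N , r) = M ℕ.⊔ N , λ k k≥ →
      p k (ℕ.m⊔n≤o⇒m≤o M N k≥) , r k (ℕ.m⊔n≤o⇒n≤o M N k≥)

    every : ∀ {m} {P : Fin m → ℕ → Set} → (∀ i → Eventually (P i)) →
            Eventually (λ k → ∀ i → P i k)
    every {zero}  h = 0 , λ _ _ ()
    every {suc m} {P} h = N , λ k k≥ → λ { zero → p k k≥ .proj₁ ; (suc i) → p k k≥ .proj₂ i }
      where
      e : Eventually (λ k → P zero k × (∀ i → P (suc i) k))
      e = both (h zero) (every (h ∘ suc))
      N = proj₁ e
      p = proj₂ e

    p₀ : Fin n
    p₀ = vertex n {{0<n}}
      where
      vertex : ∀ m .{{_ : NonZero m}} → Fin m
      vertex (suc m) = zero

    module Lower (μ : Fin n → ℝ) (hμ : IsHalf μ) (ε : ℚ) (0<ε : 0ℚ < ε) where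
      open +-*-Solver

      K : ℚ
      K = 1ℚ + Σ² {n} (λ _ _ → + 15 / 1)

      0≤Σ : 0ℚ ≤ Σ² {n} (λ _ _ → + 15 / 1)
      0≤Σ = subst (_≤ Σ² {n} (λ _ _ → + 15 / 1)) (Σ²-zero n)
        (Σ²-mono {n} (λ _ _ → 0ℚ) (λ _ _ → + 15 / 1) (λ _ _ → nonNegative⁻¹ (+ 15 / 1)))

      0<K : 0ℚ < K
      0<K = +-mono-<-≤ (positive⁻¹ 1ℚ) 0≤Σ

      r : ℚ
      r = recip K 0<K .proj₁

      Kr≡1 : K * r ≡ 1ℚ
      Kr≡1 = recip K 0<K .proj₂ .proj₂

      ¼ εr η : ℚ
      ¼  = + 1 / 4
      εr = ε * r
      η  = ¼ ⊓ εr

      0<η : 0ℚ < η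
      0<η = 0<⊓ ¼ εr (positive⁻¹ ¼) (0<* 0<ε (recip K 0<K .proj₂ .proj₁))

      0≤1-4η : 0ℚ ≤ 1ℚ - (+ 4 / 1) * η
      0≤1-4η = subst (0ℚ ≤_)
        (solve 1 (λ e → con (+ 4 / 1) :* (con ¼ :- e) := con 1ℚ :- con (+ 4 / 1) :* e) refl η)
        (0≤* (nonNegative⁻¹ (+ 4 / 1)) (gap (p⊓q≤p ¼ εr)))

      ηΣ≤ε : η * Σ² {n} (λ _ _ → + 15 / 1) ≤ ε
      ηΣ≤ε = diff (Σ * (εr - η) + εr)
        (0≤+ (0≤* 0≤Σ (gap (p⊓q≤q ¼ εr)))
             (≤-trans (<⇒≤ 0<η) (p⊓q≤q ¼ εr)))
        (trans (sym (trans (cong (ε *_) Kr≡1) (*-identityʳ ε)))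
          (solve 4 (λ S e r h → e :* ((con 1ℚ :+ S) :* r) :=
            h :* S :+ (S :* (e :* r :- h) :+ e :* r)) refl Σ ε r η))
        where
        Σ : ℚ
        Σ = Σ² {n} (λ _ _ → + 15 / 1)

      Near : ℕ → Set
      Near k = ((∀ v → 0ℚ ≤ seq (μ v) k + η) × (∀ v → seq (μ v) k ≤ 1ℚ + η)) ×
               (seq (sumᴿ μ) k ≤ + n / 2 + η × + n / 2 ≤ seq (sumᴿ μ) k + η)

      near : Eventually Near
      near = both (both (every λ v → nonneg v η 0<η) (every λ v → ≤-one v η 0<η))
                  (both (sums .proj₁ η 0<η) (sums .proj₂ η 0<η))
        where open IsHalf hμ using (nonneg; ≤-one) renaming (total to sums)

      step : ∀ k → Near k → inv * Q optimum ≤ seq (β[_,_] {{0<n}} G μ) k + ε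
      step k ((low , high) , (sum≤ , ≤sum)) =
        subst (λ b → inv * Q optimum ≤ b + ε) (sym (seq-β μ k))
          (diff (inv * ((Q x + ε) - Q optimum) + (1ℚ - inv) * ε)
            (0≤+ (0≤* 0≤inv (gap best)) (0≤* (gap inv≤1) (<⇒≤ 0<ε)))
            (solve 4 (λ a q o e → a :* q :+ e :=
              a :* o :+ (a :* ((q :+ e) :- o) :+ (con 1ℚ :- a) :* e))
              refl inv (Q x) (Q optimum) ε))
        where
        x : Fin n → ℚ
        x v = seq (μ v) k
        module A = Approximate 0<n x η (<⇒≤ 0<η) 0≤1-4η low (λ v → gap (high v))
          (subst (_≤ + n / 2 + η) (seq-sum μ k) sum≤)
          (subst (λ s → + n / 2 ≤ s + η) (seq-sum μ k) ≤sum)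
        best : Q optimum ≤ Q x + ε
        best = ≤-trans (optimum-least p₀ A.y A.y-half)
          (≤-trans A.bound (+-monoʳ-≤ (Q x) ηΣ≤ε))

      result : Eventually (λ k → inv * Q optimum ≤ seq (β[_,_] {{0<n}} G μ) k + ε)
      result = near .proj₁ , λ k k≥ → step k (near .proj₂ k k≥)

    isMinimum : IsMinimum {{0<n}} G value
    isMinimum = record
      { attained   = ν , ν-half , ν-value
      ; lowerBound = λ μ hμ ε 0<ε → Lower.result μ hμ ε 0<ε }

-- Only the specification β-isMinimum is visible to clients of β.

abstract
  minimum : ∀ {n} .{{_ : NonZero n}} (G : Graph n) → ∃ λ b → IsMinimum G b
  minimum {suc n} G = Existence.value _ G , Existence.isMinimum _ G

β : ∀ {n} .{{_ : NonZero n}} → Graph n → ℝ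
β G = proj₁ (minimum G)

β-isMinimum : ∀ {n} .{{_ : NonZero n}} (G : Graph n) → IsMinimum G (β G)
β-isMinimum G = proj₂ (minimum G)

{-# OPTIONS --safe #-}
-- Write k for the maximum degree, A for the neighbourhood of a vertex of degree k, h = n/2 − k and
-- f w = |N(w) ∩ A|, and split the complement of A into S = {2f ≤ k} and B = {2f > k}.  Adjacent
-- vertices have disjoint neighbourhoods in A, so f u + f w ≤ k along an edge and B is independent.
-- Throughout, hk ≤ n²/25 because k ≥ 2n/5.
--
-- If |S| ≥ 2h, choose u ∈ A and fill A up to a half uniformly with S ∩ N(u) or with S ∖ N(u),
-- whichever has at least h vertices.  The first is independent and has small degrees into A.  For
-- the second, the number of vertices of A adjacent to neither end of an edge w w′ is
-- k − f w − f w′, and averaging over u shows that some u is good enough.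
--
-- If |S| ≤ 2h, let t = h/|S|.  A suitable convex combination of the costs of A + t S and
-- B + (1 − t) S only involves the degrees of the vertices of S, which are at most k.
module Submission where

open import Defs
open import Algebra.Bundles using (CommutativeRing)
open import Data.Bool.Base using (Bool; true; false; not; _∧_; if_then_else_)
open import Data.Bool.Properties using (∧-conicalˡ; ∧-conicalʳ)
open import Data.Fin.Base using (Fin; zero; suc)
import Data.Fin.Properties as Fin
open import Data.Fin.Subset using (∣_∣)
open import Data.Integer.Base as ℤ using (+_)
import Data.Integer.Properties as ℤ
open import Data.List.Base using (allFin)
import Data.List.Extrema
open import Data.List.Membership.Propositional.Properties using (∈-allFin)
import Data.List.Relation.Unary.All as All
import Data.List.Relation.Unary.All.Properties as All
open import Data.Nat.Base as ℕ using (ℕ; zero; suc; NonZero)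
import Data.Nat.Properties as ℕ
open import Data.Product.Base using (∃; _×_; _,_; proj₁; proj₂)
open import Data.Rational.Base using (ℚ; 0ℚ; 1ℚ; ½; _/_; _≤_; _<_; _+_; _*_; _-_; -_; 1/_;
  nonNegative; positive)
open import Data.Rational.Properties
open import Data.Rational.Solver using (module +-*-Solver)
import Data.Rational.Unnormalised.Base as ℚᵘ
import Data.Rational.Unnormalised.Properties as ℚᵘ
open import Data.Sum.Base using (_⊎_; inj₁; inj₂)
open import Data.Vec.Base using (tabulate)
open import Function.Base using (_∘_)
open import Relation.Binary.Bundles using (DecTotalOrder)
open import Relation.Binary.Definitions using (tri<; tri≈; tri>)
open import Relation.Binary.PropositionalEquality hiding ([_])
open import Relation.Nullary using (¬_; Dec; yes; no; does; contradiction)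
open import Relation.Nullary.Decidable using (dec-true; dec-false)
open import Algebra.Properties.Semiring.Sum
  (CommutativeRing.semiring +-*-commutativeRing)
  using (sum; sum-cong-≗; sum-replicate-zero; ∑-distrib-+; ∑-comm; *-distribˡ-sum)

open +-*-Solver using (solve; con; _:+_; _:*_; _:-_; :-_; _:=_)

-- Order of the rationals.

≤-by : ∀ {p q} d → 0ℚ ≤ d → q ≡ p + d → p ≤ q
≤-by {p} {q} d 0≤d eq = subst₂ _≤_ (+-identityʳ p) (sym eq) (+-monoʳ-≤ p 0≤d)

0≤gap : ∀ {p q} → p ≤ q → 0ℚ ≤ q - p
0≤gap {p} {q} p≤q = subst (_≤ q - p) (+-inverseʳ p) (+-monoˡ-≤ (- p) p≤q)

0≤+ : ∀ {p q} → 0ℚ ≤ p → 0ℚ ≤ q → 0ℚ ≤ p + q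
0≤+ a b = +-mono-≤ a b

0≤* : ∀ {p q} → 0ℚ ≤ p → 0ℚ ≤ q → 0ℚ ≤ p * q
0≤* {p} {q} a b =
  nonNegative⁻¹ (p * q) {{nonNeg*nonNeg⇒nonNeg p {{nonNegative a}} q {{nonNegative b}}}}

0≤1 : 0ℚ ≤ 1ℚ
0≤1 = nonNegative⁻¹ 1ℚ

-- Supplies the weight per vertex when a total `p` is spread evenly over a set of size `q`.
fraction : ∀ p q → 0ℚ ≤ p → p ≤ q → 0ℚ < q → ∃ λ t → 0ℚ ≤ t × t ≤ 1ℚ × t * q ≡ p
fraction p q 0≤p p≤q 0<q = p * r , 0≤* 0≤p 0≤r ,
  subst (p * r ≤_) q*r≡1 (*-monoʳ-≤-nonNeg r {{nonNegative 0≤r}} p≤q) ,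
  trans (*-assoc p r q) (trans (cong (p *_) (trans (*-comm r q) q*r≡1)) (*-identityʳ p))
  where
  instance q≢0 = pos⇒nonZero q {{positive 0<q}}
  r : ℚ
  r = 1/ q
  0≤r : 0ℚ ≤ r
  0≤r = <⇒≤ (positive⁻¹ r {{1/pos⇒pos q {{positive 0<q}}}})
  q*r≡1 : q * r ≡ 1ℚ
  q*r≡1 = *-inverseʳ q

-- Natural numbers as rationals.

-- Abstract, as unfolding the normalisation of fractions on open terms is prohibitively slow.

abstract
  ι : ℕ → ℚ
  ι a = + a / 1

  ι-≡ : ∀ a → ι a ≡ + a / 1
  ι-≡ a = refl

  ι-zero : ι 0 ≡ 0ℚ
  ι-zero = refl

  ι-suc : ∀ a → ι (suc a) ≡ 1ℚ + ι a
  ι-suc a = toℚᵘ-injective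
    (ℚᵘ.≃-trans (toℚᵘ-fromℚᵘ (ℚᵘ.mkℚᵘ (+ suc a) 0))
    (ℚᵘ.≃-trans (ℚᵘ.*≡* (cong (ℤ._* + 1) (cong (ℤ._+_ (+ 1)) (sym (ℤ.*-identityʳ (+ a))))))
    (ℚᵘ.≃-sym (ℚᵘ.≃-trans (toℚᵘ-homo-+ 1ℚ (ι a))
      (ℚᵘ.+-cong (ℚᵘ.≃-refl {ℚᵘ.1ℚᵘ}) (toℚᵘ-fromℚᵘ (ℚᵘ.mkℚᵘ (+ a) 0)))))))

  ι-*-/ : ∀ a b d .{{_ : NonZero d}} → ι a * (+ b / d) ≡ + (a ℕ.* b) / d
  ι-*-/ a b (suc d) = toℚᵘ-injective
    (ℚᵘ.≃-trans (toℚᵘ-homo-* (ι a) (+ b / suc d))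
    (ℚᵘ.≃-trans (ℚᵘ.*-cong (toℚᵘ-fromℚᵘ (ℚᵘ.mkℚᵘ (+ a) 0)) (toℚᵘ-fromℚᵘ (ℚᵘ.mkℚᵘ (+ b) d)))
    (ℚᵘ.≃-trans (ℚᵘ.*≡* (cong₂ ℤ._*_ (sym (ℤ.pos-* a b))
      (cong (λ e → + suc e) (sym (ℕ.+-identityʳ d)))))
    (ℚᵘ.≃-sym (toℚᵘ-fromℚᵘ (ℚᵘ.mkℚᵘ (+ (a ℕ.* b)) d))))))

n/n≡1 : ∀ n .{{_ : NonZero n}} → + n / n ≡ 1ℚ
n/n≡1 (suc n) = fromℚᵘ-cong {ℚᵘ.mkℚᵘ (+ suc n) n} {ℚᵘ.mkℚᵘ (+ 1) 0}
  (ℚᵘ.*≡* (ℤ.*-comm (+ suc n) (+ 1)))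

-- Finite sums, indicators and averaging.

sum-mono : ∀ {n} (f g : Fin n → ℚ) → (∀ i → f i ≤ g i) → sum f ≤ sum g
sum-mono {zero}  f g h = ≤-refl
sum-mono {suc n} f g h = +-mono-≤ (h zero) (sum-mono (f ∘ suc) (g ∘ suc) (h ∘ suc))

sum-zero : ∀ {n} (f : Fin n → ℚ) → (∀ i → f i ≡ 0ℚ) → sum f ≡ 0ℚ
sum-zero {n} f h = trans (sum-cong-≗ h) (sum-replicate-zero n)

sum-nonneg : ∀ {n} (f : Fin n → ℚ) → (∀ i → 0ℚ ≤ f i) → 0ℚ ≤ sum f
sum-nonneg {n} f h = subst (_≤ sum f) (sum-replicate-zero n) (sum-mono (λ _ → 0ℚ) f h)

sum-linear : ∀ {n} t (f g : Fin n → ℚ) → sum (λ i → f i + t * g i) ≡ sum f + t * sum g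
sum-linear t f g =
  trans (∑-distrib-+ f (λ i → t * g i)) (cong (_+_ (sum f)) (sym (*-distribˡ-sum t g)))

sum-ones : ∀ n → sum {n} (λ _ → 1ℚ) ≡ ι n
sum-ones zero    = sym ι-zero
sum-ones (suc n) = trans (cong (_+_ 1ℚ) (sum-ones n)) (sym (ι-suc n))

[_] : Bool → ℚ
[ b ] = if b then 1ℚ else 0ℚ

0≤[_] : ∀ b → 0ℚ ≤ [ b ]
0≤[ true ]  = 0≤1
0≤[ false ] = ≤-refl

[_]≤1 : ∀ b → [ b ] ≤ 1ℚ
[ true ]≤1  = ≤-refl
[ false ]≤1 = 0≤1

size : ∀ {n} → (Fin n → Bool) → ℚ
size b = sum λ i → [ b i ]

size-tabulate : ∀ {n} (b : Fin n → Bool) → ι ∣ tabulate b ∣ ≡ size b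
size-tabulate {zero}  b = ι-zero
size-tabulate {suc n} b with b zero
... | true  = trans (ι-suc ∣ tabulate (b ∘ suc) ∣) (cong (_+_ 1ℚ) (size-tabulate (b ∘ suc)))
... | false = trans (size-tabulate (b ∘ suc)) (sym (+-identityˡ _))

-- Without a witness every selected term is negative, so the sum is negative as soon as one index is
-- selected. The induction has to keep the empty selection apart, because its sum is zero.
search : ∀ {n} (b : Fin n → Bool) (g : Fin n → ℚ) →
         (∃ λ i → b i ≡ true × 0ℚ ≤ g i) ⊎
         (sum (λ i → [ b i ] * g i) < 0ℚ ⊎ (size b ≡ 0ℚ × sum (λ i → [ b i ] * g i) ≡ 0ℚ))
search {zero} b g = inj₂ (inj₂ (refl , refl))
search {suc n} b g with search (b ∘ suc) (g ∘ suc)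
... | inj₁ (i , bi , gi) = inj₁ (suc i , bi , gi)
... | inj₂ rest with b zero in b₀ | 0ℚ ≤? g zero
...   | true  | yes 0≤g = inj₁ (zero , b₀ , 0≤g)
...   | true  | no 0≰g  = inj₂ (inj₁ (+-mono-<-≤
  (subst (_< 0ℚ) (sym (*-identityˡ (g zero))) (≰⇒> 0≰g)) (rest≤ rest)))
  where
  rest≤ : ∀ {s p} → s < 0ℚ ⊎ (p ≡ 0ℚ × s ≡ 0ℚ) → s ≤ 0ℚ
  rest≤ (inj₁ s<0)       = <⇒≤ s<0
  rest≤ (inj₂ (_ , s≡0)) = ≤-reflexive s≡0
...   | false | _ = inj₂ (shift rest)
  where
  0g : 0ℚ * g zero ≡ 0ℚ
  0g = *-zeroˡ (g zero)
  shift : ∀ {s p} → s < 0ℚ ⊎ (p ≡ 0ℚ × s ≡ 0ℚ) →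
          0ℚ * g zero + s < 0ℚ ⊎ (0ℚ + p ≡ 0ℚ × 0ℚ * g zero + s ≡ 0ℚ)
  shift (inj₁ s<0)         = inj₁ (+-mono-≤-< (≤-reflexive 0g) s<0)
  shift (inj₂ (p≡0 , s≡0)) = inj₂ (cong (_+_ 0ℚ) p≡0 , cong₂ _+_ 0g s≡0)

some-nonneg : ∀ {n} (b : Fin n → Bool) (g : Fin n → ℚ) → 0ℚ < size b →
              0ℚ ≤ sum (λ i → [ b i ] * g i) → ∃ λ i → b i ≡ true × 0ℚ ≤ g i
some-nonneg b g 0<b 0≤s with search b g
... | inj₁ found            = found
... | inj₂ (inj₁ s<0)       = contradiction (<-≤-trans s<0 0≤s) (<-irrefl refl)
... | inj₂ (inj₂ (b≡0 , _)) = contradiction (sym b≡0) (<⇒≢ 0<b)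

[]*-nonneg : ∀ b {x} → (b ≡ true → 0ℚ ≤ x) → 0ℚ ≤ [ b ] * x
[]*-nonneg true  {x} h = subst (0ℚ ≤_) (sym (*-identityˡ x)) (h refl)
[]*-nonneg false {x} h = ≤-reflexive (sym (*-zeroˡ x))

[]*-mono : ∀ b {x y} → (b ≡ true → x ≤ y) → [ b ] * x ≤ [ b ] * y
[]*-mono true  {x} {y} h = subst₂ _≤_ (sym (*-identityˡ x)) (sym (*-identityˡ y)) (h refl)
[]*-mono false {x} {y} h = ≤-reflexive (trans (*-zeroˡ x) (sym (*-zeroˡ y)))

[∧] : ∀ x y → [ x ∧ y ] ≡ [ x ] * [ y ]
[∧] true  y = sym (*-identityˡ [ y ])
[∧] false y = sym (*-zeroˡ [ y ])

does⇒ : ∀ {P : Set} (d : Dec P) → does d ≡ true → P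
does⇒ (yes p) refl = p

does⇏ : ∀ {P : Set} (d : Dec P) → not (does d) ≡ true → ¬ P
does⇏ (no ¬p) refl = ¬p

-- Abstract for the same reason as ι.

abstract
  infix 5 _≤?ᵇ_
  _≤?ᵇ_ : ℚ → ℚ → Bool
  p ≤?ᵇ q = does (p ≤? q)

  ≤?ᵇ⇒≤ : ∀ {p q} → p ≤?ᵇ q ≡ true → p ≤ q
  ≤?ᵇ⇒≤ {p} {q} = does⇒ (p ≤? q)

  ≰?ᵇ⇒> : ∀ {p q} → not (p ≤?ᵇ q) ≡ true → q < p
  ≰?ᵇ⇒> {p} {q} h = ≰⇒> (does⇏ (p ≤? q) h)

-- Polynomial identities and inequalities for the costs.

exclusive : ∀ x y → x ∧ not y ≡ true → x ∧ y ≡ false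
exclusive true  false _ = refl

1-t≤1 : ∀ t → 0ℚ ≤ t → 1ℚ - t ≤ 1ℚ
1-t≤1 t 0≤t = ≤-by t 0≤t (solve 1 (λ t → con 1ℚ := (con 1ℚ :- t) :+ t) refl t)

remaining : ∀ N k b s → N ≡ k + b + s → s ≡ (½ * N - k) + (½ * N - b)
remaining N k b s refl = solve 3 (λ k b s → let N = k :+ b :+ s in
  s := (con ½ :* N :- k) :+ (con ½ :* N :- b)) refl k b s

-- Since N = k + b + s, taking N/2 - k out of s leaves exactly what b lacks to reach N/2.
complement-size : ∀ N k b s t → N ≡ k + b + s → t * s ≡ ½ * N - k → b + (1ℚ - t) * s ≡ ½ * N
complement-size N k b s t eq ts≡h = trans
  (solve 3 (λ b s t → b :+ (con 1ℚ :- t) :* s := b :+ (s :- t :* s)) refl b s t)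
  (trans (cong₂ (λ x y → b + (x - y)) (remaining N k b s eq) ts≡h)
    (solve 3 (λ N k b → let h = con ½ :* N :- k in b :+ ((h :+ (con ½ :* N :- b)) :- h) := con ½ :* N)
      refl N k b))

-- The larger of `x` and `y` is at least their convex combination.
one-nonneg : ∀ t x y → 0ℚ ≤ t → t ≤ 1ℚ → 0ℚ ≤ (1ℚ - t) * x + t * y → 0ℚ ≤ x ⊎ 0ℚ ≤ y
one-nonneg t x y 0≤t t≤1 0≤mix with ≤-total x y
... | inj₁ x≤y = inj₂ (≤-trans 0≤mix (≤-by ((1ℚ - t) * (y - x)) (0≤* (0≤gap t≤1) (0≤gap x≤y))
  (solve 3 (λ t x y → y := ((con 1ℚ :- t) :* x :+ t :* y) :+ (con 1ℚ :- t) :* (y :- x)) refl t x y)))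
... | inj₂ y≤x = inj₁ (≤-trans 0≤mix (≤-by (t * (x - y)) (0≤* 0≤t (0≤gap y≤x))
  (solve 3 (λ t x y → x := ((con 1ℚ :- t) :* x :+ t :* y) :+ t :* (x :- y)) refl t x y)))

-- The weights 1 - t and t give both costs the common factor t(1 - t), and the remaining factors add
-- up to 2F + 2F′ + E, which is at most 2ks. The hypothesis s ≤ 2ts then bounds 2t(1 - t)ks by kts.
mixed-cost : ∀ N k s t E F F′ → 0ℚ ≤ k → 0ℚ ≤ E → 0ℚ ≤ t → t ≤ 1ℚ →
             (+ 25 / 1) * (k * (t * s)) ≤ N * N → F + F′ + E ≤ k * s → s ≤ t * s + t * s →
             0ℚ ≤ (1ℚ - t) * (N * N - (+ 25 / 1) * (t * (F + F + t * E))) +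
                  t * (N * N - (+ 25 / 1) * ((1ℚ - t) * (F′ + F′ + (1ℚ - t) * E)))
mixed-cost N k s t E F F′ 0≤k 0≤E 0≤t t≤1 25kts≤N² F+F′+E≤ks s≤2ts =
  subst (0ℚ ≤_)
    (solve 7 (λ N k s t E F F′ →
      ((N :* N :- con (+ 25 / 1) :* (k :* (t :* s))) :+
        con (+ 25 / 1) :* (k :* (t :* (t :* s :+ t :* s :- s)))) :+
      con (+ 25 / 1) :* (t :* ((con 1ℚ :- t) :* (con (+ 2 / 1) :* (k :* s :- (F :+ F′ :+ E)) :+ E))) :=
      (con 1ℚ :- t) :* (N :* N :- con (+ 25 / 1) :* (t :* (F :+ F :+ t :* E))) :+
      t :* (N :* N :- con (+ 25 / 1) :* ((con 1ℚ :- t) :* (F′ :+ F′ :+ (con 1ℚ :- t) :* E))))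
      refl N k s t E F F′)
    (0≤+ (0≤+ (0≤gap 25kts≤N²) (0≤* 0≤25 (0≤* 0≤k (0≤* 0≤t (0≤gap s≤2ts)))))
      (0≤* 0≤25 (0≤* 0≤t (0≤* (0≤gap t≤1)
        (0≤+ (0≤* (nonNegative⁻¹ (+ 2 / 1)) (0≤gap F+F′+E≤ks)) 0≤E)))))
  where
  0≤25 : 0ℚ ≤ + 25 / 1
  0≤25 = nonNegative⁻¹ (+ 25 / 1)

scale-up : ∀ n i d → 0ℚ ≤ n → n * i ≡ 1ℚ → + 2 / 5 ≤ d * i → (+ 2 / 1) * n ≤ (+ 5 / 1) * d
scale-up n i d 0≤n ni≡1 2/5≤di = ≤-by ((+ 5 / 1) * (n * (d * i - + 2 / 5)))
  (0≤* (nonNegative⁻¹ (+ 5 / 1)) (0≤* 0≤n (0≤gap 2/5≤di)))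
  (trans (cong ((+ 5 / 1) *_) (sym (trans (cong (d *_) ni≡1) (*-identityʳ d))))
    (solve 3 (λ n i d → con (+ 5 / 1) :* (d :* (n :* i)) :=
      con (+ 2 / 1) :* n :+ con (+ 5 / 1) :* (n :* (d :* i :- con (+ 2 / 5)))) refl n i d))

[∧not] : ∀ x y → [ x ∧ not y ] ≡ [ x ] + - 1ℚ * [ x ∧ y ]
[∧not] true  true  = refl
[∧not] true  false = refl
[∧not] false _     = refl

0≤gap⁻¹ : ∀ {p q} → 0ℚ ≤ q - p → p ≤ q
0≤gap⁻¹ {p} {q} h = ≤-by (q - p) h (solve 2 (λ p q → q := p :+ (q :- p)) refl p q)

interchange : ∀ x y → (x + y) + (x + y) ≡ (x + x) + (y + y)
interchange = solve 2 (λ x y → (x :+ y) :+ (x :+ y) := (x :+ x) :+ (y :+ y)) refl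

remainder : ∀ m h p → h + h ≤ m → p ≤ h → h ≤ m + - 1ℚ * p
remainder m h p 2h≤m p≤h = ≤-by ((m - (h + h)) + (h - p)) (0≤+ (0≤gap 2h≤m) (0≤gap p≤h))
  (solve 3 (λ m h p → m :+ con (- 1ℚ) :* p := h :+ ((m :- (h :+ h)) :+ (h :- p))) refl m h p)

slack-term : ∀ p g f k → p * ((g + g) + (f + f) - k) ≡ ((p * g + p * g) + (p * f + p * f)) + - k * p
slack-term = solve 4 (λ p g f k → p :* ((g :+ g) :+ (f :+ f) :- k) :=
  ((p :* g :+ p :* g) :+ (p :* f :+ p :* f)) :+ (:- k) :* p) refl

slack-regroup : ∀ k m F E p g l →
  (k * m - (F + F) - E) + ((g + g) + (l + l) + - k * p) ≡
  k * (m + - 1ℚ * p) - ((E + - 1ℚ * (g + g + - 1ℚ * 0ℚ)) + ((F + - 1ℚ * l) + (F + - 1ℚ * l)))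
slack-regroup = solve 7 (λ k m F E p g l →
  (k :* m :- (F :+ F) :- E) :+ ((g :+ g) :+ (l :+ l) :+ (:- k) :* p) :=
  k :* (m :+ con (- 1ℚ) :* p) :- ((E :+ con (- 1ℚ) :* (g :+ g :+ con (- 1ℚ) :* con 0ℚ)) :+
    ((F :+ con (- 1ℚ) :* l) :+ (F :+ con (- 1ℚ) :* l)))) refl

weigh : ∀ a c r → a * (c + r) ≡ a * r + c * a
weigh = solve 3 (λ a c r → a :* (c :+ r) := a :* r :+ c :* a) refl

-- The factorisation behind the averaging argument: for suitable `f` and `g` both factors on the
-- left are non-negative, while the right side is what summing the slacks produces.
slack-factor : ∀ s f g k → s * ((k - (f + f)) * (k - (f + g))) ≡
  (s * ((g + g) + (f + f) - k)) * f + k * (- 1ℚ * (s * f + s * f + s * g) + k * s)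
slack-factor = solve 4 (λ s f g k → s :* ((k :- (f :+ f)) :* (k :- (f :+ g))) :=
  (s :* ((g :+ g) :+ (f :+ f) :- k)) :* f :+
    k :* (con (- 1ℚ) :* (s :* f :+ s :* f :+ s :* g) :+ k :* s)) refl

regroup : ∀ k m F E → - 1ℚ * (F + F + E) + k * m ≡ k * m - (F + F) - E
regroup = solve 4 (λ k m F E → con (- 1ℚ) :* (F :+ F :+ E) :+ k :* m := k :* m :- (F :+ F) :- E) refl

distribute : ∀ d a b s → d * (a + b + s) ≡ (d * a + d * s) + d * b
distribute = solve 4 (λ d a b s → d :* (a :+ b :+ s) := (d :* a :+ d :* s) :+ d :* b) refl

vanishing : ∀ t → (+ 25 / 1) * (t * (0ℚ + 0ℚ + t * 0ℚ)) ≡ 0ℚ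
vanishing = solve 1 (λ t → con (+ 25 / 1) :* (t :* (con 0ℚ :+ con 0ℚ :+ t :* con 0ℚ)) := con 0ℚ) refl

add-deficit : ∀ N k → k + (½ * N - k) ≡ ½ * N
add-deficit = solve 2 (λ N k → k :+ (con ½ :* N :- k) := con ½ :* N) refl

-- As t ≤ 1, the cost t(2F + tE) is at most t(2F + E), hence at most ktm.
join-cost : ∀ N k t m E F → 0ℚ ≤ t → t ≤ 1ℚ → 0ℚ ≤ E →
            (+ 25 / 1) * (k * (t * m)) ≤ N * N → E + (F + F) ≤ k * m →
            (+ 25 / 1) * (t * (F + F + t * E)) ≤ N * N
join-cost N k t m E F 0≤t t≤1 0≤E 25ktm≤N² E+2F≤km =
  ≤-by ((N * N - (+ 25 / 1) * (k * (t * m))) +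
        (+ 25 / 1) * (t * ((k * m - (E + (F + F))) + (1ℚ - t) * E)))
    (0≤+ (0≤gap 25ktm≤N²)
      (0≤* (nonNegative⁻¹ (+ 25 / 1)) (0≤* 0≤t (0≤+ (0≤gap E+2F≤km) (0≤* (0≤gap t≤1) 0≤E)))))
    (solve 6 (λ N k m t E F → N :* N :=
      con (+ 25 / 1) :* (t :* (F :+ F :+ t :* E)) :+
      ((N :* N :- con (+ 25 / 1) :* (k :* (t :* m))) :+
        con (+ 25 / 1) :* (t :* ((k :* m :- (E :+ (F :+ F))) :+ (con 1ℚ :- t) :* E))))
      refl N k m t E F)

-- Comparing reals through their sequences.

≤ᴿ-pointwise : ∀ x y → (∀ k → seq x k ≤ seq y k) → x ≤ᴿ y
≤ᴿ-pointwise x y h ε 0<ε = 0 , λ k _ → ≤-trans (h k)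
  (≤-by ε (<⇒≤ 0<ε) refl)

≤ᴿ-fromℚ : ∀ x y {q} → x ≤ᴿ y → (∀ k → seq y k ≤ q) → x ≤ᴿ fromℚ q
≤ᴿ-fromℚ x y x≤y y≤q ε 0<ε with x≤y ε 0<ε
... | N , h = N , λ k N≤k → ≤-trans (h k N≤k) (+-monoˡ-≤ ε (y≤q k))

seq-sum : ∀ {m} (f : Fin m → ℝ) k → seq (sumᴿ f) k ≡ sum (λ i → seq (f i) k)
seq-sum {zero}  f k = refl
seq-sum {suc m} f k = cong (_+_ (seq (f zero) k)) (seq-sum (f ∘ suc) k)

-- The bilinear form of the adjacency matrix.

module Edges {n : ℕ} (G : Graph n) where
  open Graph G

  adj : Fin n → Fin n → ℚ
  adj u w = [ does (u ~? w) ]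

  adj-sym : ∀ u w → adj u w ≡ adj w u
  adj-sym u w with u ~? w
  ... | yes u~w = cong [_] (sym (dec-true (w ~? u) (~-sym u~w)))
  ... | no u≁w  = cong [_] (sym (dec-false (w ~? u) (u≁w ∘ ~-sym)))

  adj-irr : ∀ u → adj u u ≡ 0ℚ
  adj-irr u = cong [_] (dec-false (u ~? u) (~-irr refl))

  -- Multiplication by the adjacency matrix; on an indicator it counts the neighbours inside the
  -- set.
  nbr : (Fin n → ℚ) → Fin n → ℚ
  nbr x u = sum λ w → adj u w * x w

  infix 5 ⟨_,_⟩
  -- On two indicators this counts the ordered adjacent pairs from the first set to the second.
  ⟨_,_⟩ : (Fin n → ℚ) → (Fin n → ℚ) → ℚ
  ⟨ x , y ⟩ = sum λ u → x u * nbr y u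

  nbr-linear : ∀ t x y u → nbr (λ w → x w + t * y w) u ≡ nbr x u + t * nbr y u
  nbr-linear t x y u = trans
    (sum-cong-≗ λ w → solve 4 (λ a x t y → a :* (x :+ t :* y) := a :* x :+ t :* (a :* y))
      refl (adj u w) (x w) t (y w))
    (sum-linear t (λ w → adj u w * x w) (λ w → adj u w * y w))

  ⟨⟩-linearˡ : ∀ t x y z → ⟨ (λ w → x w + t * y w) , z ⟩ ≡ ⟨ x , z ⟩ + t * ⟨ y , z ⟩
  ⟨⟩-linearˡ t x y z = trans
    (sum-cong-≗ λ u → solve 4 (λ x t y z → (x :+ t :* y) :* z := x :* z :+ t :* (y :* z))
      refl (x u) t (y u) (nbr z u))
    (sum-linear t (λ u → x u * nbr z u) (λ u → y u * nbr z u))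

  ⟨⟩-comm : ∀ x y → ⟨ x , y ⟩ ≡ ⟨ y , x ⟩
  ⟨⟩-comm x y = trans (expand x y) (trans (∑-comm (λ u w → x u * (adj u w * y w)))
    (trans (sum-cong-≗ λ w → sum-cong-≗ λ u → swap u w) (sym (expand y x))))
    where
    expand : ∀ x y → ⟨ x , y ⟩ ≡ sum λ u → sum λ w → x u * (adj u w * y w)
    expand x y = sum-cong-≗ λ u → *-distribˡ-sum (x u) (λ w → adj u w * y w)
    swap : ∀ u w → x u * (adj u w * y w) ≡ y w * (adj w u * x u)
    swap u w = trans (cong (λ a → x u * (a * y w)) (adj-sym u w))
      (solve 3 (λ x a y → x :* (a :* y) := y :* (a :* x)) refl (x u) (adj w u) (y w))

  quad : (Fin n → ℚ) → ℚ
  quad x = ⟨ x , x ⟩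

  -- Symmetry of the form merges the two cross terms. In each use one of `x` and `y` is the
  -- indicator of an independent set, so that its own term vanishes.
  quad-+ : ∀ t x y → quad (λ w → x w + t * y w) ≡ quad x + t * (⟨ y , x ⟩ + ⟨ y , x ⟩ + t * quad y)
  quad-+ t x y = trans (⟨⟩-linearˡ t x y z)
    (trans (cong₂ (λ p q → p + t * q) (right x) (right y))
    (trans (cong (λ p → (quad x + t * p) + t * (⟨ y , x ⟩ + t * quad y)) (⟨⟩-comm x y))
      (solve 4 (λ X t c Y → (X :+ t :* c) :+ t :* (c :+ t :* Y) := X :+ t :* (c :+ c :+ t :* Y))
        refl (quad x) t ⟨ y , x ⟩ (quad y))))
    where
    z : Fin n → ℚ
    z w = x w + t * y w
    right : ∀ x′ → ⟨ x′ , z ⟩ ≡ ⟨ x′ , x ⟩ + t * ⟨ x′ , y ⟩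
    right x′ = trans (⟨⟩-comm x′ z) (trans (⟨⟩-linearˡ t x y x′)
      (cong₂ (λ p q → p + t * q) (⟨⟩-comm x x′) (⟨⟩-comm y x′)))

  ⟨⟩-cong : ∀ {x x′ y y′} → (∀ w → x w ≡ x′ w) → (∀ w → y w ≡ y′ w) → ⟨ x , y ⟩ ≡ ⟨ x′ , y′ ⟩
  ⟨⟩-cong x≗x′ y≗y′ = sum-cong-≗ λ u → cong₂ _*_ (x≗x′ u) (sum-cong-≗ λ w → cong (adj u w *_) (y≗y′ w))

  nbr-nonneg : ∀ x → (∀ w → 0ℚ ≤ x w) → ∀ u → 0ℚ ≤ nbr x u
  nbr-nonneg x 0≤x u = sum-nonneg _ λ w → 0≤* 0≤[ does (u ~? w) ] (0≤x w)

  ⟨⟩-nonneg : ∀ x y → (∀ w → 0ℚ ≤ x w) → (∀ w → 0ℚ ≤ y w) → 0ℚ ≤ ⟨ x , y ⟩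
  ⟨⟩-nonneg x y 0≤x 0≤y = sum-nonneg _ λ u → 0≤* (0≤x u) (nbr-nonneg y 0≤y u)

  Independent : (Fin n → Bool) → Set
  Independent b = ∀ u w → b u ≡ true → b w ≡ true → ¬ (u ~ w)

  quad-independent : ∀ b → Independent b → quad ([_] ∘ b) ≡ 0ℚ
  quad-independent b ind = sum-zero _ λ u → trans (*-distribˡ-sum [ b u ] (λ w → adj u w * [ b w ]))
    (sum-zero _ (term u))
    where
    term : ∀ u w → [ b u ] * (adj u w * [ b w ]) ≡ 0ℚ
    term u w with b u in bu | u ~? w | b w in bw
    ... | false | d       | q     = *-zeroˡ ([ does d ] * [ q ])
    ... | true  | no _    | q     = cong (1ℚ *_) (*-zeroˡ [ q ])
    ... | true  | yes _   | false = refl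
    ... | true  | yes u~w | true  = contradiction u~w (ind u w bu bw)

  forward : (Fin n → ℚ) → Fin n → Fin n → ℚ
  forward x u w = [ does (u Fin.<? w) ∧ does (u ~? w) ] * (x u * x w)

  -- An adjacent pair is increasing or decreasing, as no vertex is adjacent to itself, and
  -- exchanging the summations turns the decreasing pairs into the increasing ones.
  quad-forward : ∀ x →
    quad x ≡ (sum λ u → sum λ w → forward x u w) + (sum λ u → sum λ w → forward x u w)
  quad-forward x = trans (sum-cong-≗ λ u → *-distribˡ-sum (x u) (λ w → adj u w * x w))
    (trans (sum-cong-≗ λ u → trans (sum-cong-≗ (term u))
      (∑-distrib-+ (λ w → forward x u w) (λ w → forward x w u)))
    (trans (∑-distrib-+ (λ u → sum (λ w → forward x u w)) (λ u → sum (λ w → forward x w u)))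
      (cong (_+_ (sum λ u → sum λ w → forward x u w)) (∑-comm (λ u w → forward x w u)))))
    where
    split : ∀ u w → adj u w ≡
      [ does (u Fin.<? w) ∧ does (u ~? w) ] + [ does (w Fin.<? u) ∧ does (w ~? u) ]
    split u w with Fin.<-cmp u w
    ... | tri< u<w _ w≮u = trans (sym (+-identityʳ (adj u w)))
      (cong₂ (λ p q → [ p ∧ does (u ~? w) ] + [ q ∧ does (w ~? u) ])
        (sym (dec-true (u Fin.<? w) u<w)) (sym (dec-false (w Fin.<? u) w≮u)))
    ... | tri> u≮w _ w<u = trans (adj-sym u w) (trans (sym (+-identityˡ (adj w u)))
      (cong₂ (λ p q → [ p ∧ does (u ~? w) ] + [ q ∧ does (w ~? u) ])
        (sym (dec-false (u Fin.<? w) u≮w)) (sym (dec-true (w Fin.<? u) w<u))))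
    ... | tri≈ u≮w refl _ = trans (adj-irr u)
      (cong (λ p → [ p ∧ does (u ~? u) ] + [ p ∧ does (u ~? u) ]) (sym (dec-false (u Fin.<? u) u≮w)))
    term : ∀ u w → x u * (adj u w * x w) ≡ forward x u w + forward x w u
    term u w = trans (cong (λ a → x u * (a * x w)) (split u w))
      (solve 4 (λ x a b y → x :* ((a :+ b) :* y) := a :* (x :* y) :+ b :* (y :* x)) refl
        (x u) [ does (u Fin.<? w) ∧ does (u ~? w) ] [ does (w Fin.<? u) ∧ does (w ~? u) ] (x w))

  -- Sparse rational halves and the bound on β.

  record SparseHalf (x : Fin n → ℚ) : Set where
    field
      lower  : ∀ u → 0ℚ ≤ x u
      upper  : ∀ u → x u ≤ 1ℚ
      total  : sum x ≡ ½ * ι n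
      sparse : (+ 25 / 1) * quad x ≤ ι n * ι n

  -- Sums of adjacent pairs count each edge twice, whence 1/25 in place of 1/50.

  sparse⇒β≤ : .{{_ : NonZero n}} → ∀ x → SparseHalf x → β G ≤ᴿ fromℚ (+ 1 / 50)
  sparse⇒β≤ x sh = ≤ᴿ-fromℚ (β G) β[ G , μ ] (lowerBound μ half) bound
    where
    open SparseHalf sh
    open IsMinimum (β-isMinimum G)
    μ : Fin n → ℝ
    μ u = fromℚ (x u)
    total-eq : ∀ k → seq (sumᴿ μ) k ≡ + n / 2
    total-eq k = trans (seq-sum μ k) (trans total (trans (*-comm ½ (ι n))
      (trans (ι-*-/ n 1 2) (cong (λ m → + m / 2) (ℕ.*-identityʳ n)))))
    half : IsHalf μ
    half = record
      { nonneg = λ u → ≤ᴿ-pointwise 0ᴿ (μ u) λ _ → lower u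
      ; ≤-one  = λ u → ≤ᴿ-pointwise (μ u) 1ᴿ λ _ → upper u
      ; total  = ≤ᴿ-pointwise (sumᴿ μ) (fromℚ (+ n / 2)) (λ k → ≤-reflexive (total-eq k))
               , ≤ᴿ-pointwise (fromℚ (+ n / 2)) (sumᴿ μ) (λ k → ≤-reflexive (sym (total-eq k))) }
    weight : ∀ u w k → seq (edgeWeight G μ u w) k ≡ forward x u w
    weight u w k with does (u Fin.<? w) ∧ does (u ~? w)
    ... | true  = sym (*-identityˡ (x u * x w))
    ... | false = sym (*-zeroˡ (x u * x w))
    E : ℚ
    E = sum λ u → sum λ w → forward x u w
    seq-β : ∀ k → seq (β[ G , μ ]) k ≡ 1/n² n * E
    seq-β k = cong (1/n² n *_) (trans (seq-sum (λ u → sumᴿ λ w → edgeWeight G μ u w) k)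
      (sum-cong-≗ λ u → trans (seq-sum (λ w → edgeWeight G μ u w) k) (sum-cong-≗ λ w → weight u w k)))
    unit : 1/n² n * (ι n * ι n) ≡ 1ℚ
    unit = trans (*-comm (1/n² n) (ι n * ι n))
      (trans (cong (_* 1/n² n) (trans (cong (ι n *_) (ι-≡ n))
        (trans (ι-*-/ n n 1) (sym (ι-≡ (n ℕ.* n))))))
      (trans (ι-*-/ (n ℕ.* n) 1 (n ℕ.* n) {{n²≢0}})
      (trans (cong (λ m → (+ m / (n ℕ.* n)) {{n²≢0}}) (ℕ.*-identityʳ (n ℕ.* n)))
        (n/n≡1 (n ℕ.* n) {{n²≢0}}))))
      where n²≢0 = ℕ.m*n≢0 n n
    0≤1/n² : 0ℚ ≤ 1/n² n
    0≤1/n² = nonNegative⁻¹ (1/n² n) {{normalize-nonNeg 1 (n ℕ.* n) {{ℕ.m*n≢0 n n}}}}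
    bound : ∀ k → seq (β[ G , μ ]) k ≤ + 1 / 50
    bound k = subst (_≤ + 1 / 50) (sym (seq-β k))
      -- `unit` writes 1/50 as 1/50 times n²/n², so the gap to the bound is a multiple of the gap in
      -- `sparse`; `quad-forward` replaces `quad x` by twice the edge sum.
      (≤-by ((+ 1 / 50) * (1/n² n * (ι n * ι n - (+ 25 / 1) * quad x)))
        (0≤* (nonNegative⁻¹ (+ 1 / 50)) (0≤* 0≤1/n² (0≤gap sparse)))
        (trans (cong ((+ 1 / 50) *_) (sym unit))
        (trans (solve 3 (λ i N E → con (+ 1 / 50) :* (i :* N) :=
            i :* E :+ con (+ 1 / 50) :* (i :* (N :- con (+ 25 / 1) :* (E :+ E))))
            refl (1/n² n) (ι n * ι n) E)
          (cong (λ q → 1/n² n * E + (+ 1 / 50) * (1/n² n * (ι n * ι n - (+ 25 / 1) * q)))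
            (sym (quad-forward x))))))

-- From a large independent set to a sparse half.

module LargeIndependentSet {n : ℕ} (G : Graph n) (tf : TriangleFree G) (0<n : 0ℚ < ι n)
  (a : Fin n → Bool) (a-ind : Edges.Independent G a)
  (degree≤ : ∀ u → Edges.nbr G (λ _ → 1ℚ) u ≤ size a)
  (2n≤5k : (+ 2 / 1) * ι n ≤ (+ 5 / 1) * size a)
  where

  open Graph G
  open Edges G

  N k h : ℚ
  N = ι n
  k = size a
  h = ½ * N - k

  A : Fin n → ℚ
  A w = [ a w ]

  f : Fin n → ℚ
  f = nbr A

  0≤k : 0ℚ ≤ k
  0≤k = sum-nonneg A λ w → 0≤[ a w ]

  -- N² − 25 k h = (5k − 2N)(5k − N/2)
  25kh≤N² : (+ 25 / 1) * (k * h) ≤ N * N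
  25kh≤N² = ≤-by (d * (d + (+ 3 / 2) * N))
    (0≤* (0≤gap 2n≤5k) (0≤+ (0≤gap 2n≤5k) (0≤* (nonNegative⁻¹ (+ 3 / 2)) (<⇒≤ 0<n))))
    (solve 2 (λ N k → let d = con (+ 5 / 1) :* k :- con (+ 2 / 1) :* N in
      N :* N := con (+ 25 / 1) :* (k :* (con ½ :* N :- k)) :+ d :* (d :+ con (+ 3 / 2) :* N))
      refl N k)
    where
    d : ℚ
    d = (+ 5 / 1) * k - (+ 2 / 1) * N

  Good : Set
  Good = ∃ SparseHalf

  -- An independent `b` contributes no edges of its own, so only the edges that meet `c` have a
  -- cost; disjointness keeps the weights at most 1.
  extend : ∀ b c t → Independent b → (∀ w → b w ≡ true → c w ≡ false) → 0ℚ ≤ t → t ≤ 1ℚ →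
           size b + t * size c ≡ ½ * N →
           (+ 25 / 1) *
             (t * (⟨ [_] ∘ c , [_] ∘ b ⟩ + ⟨ [_] ∘ c , [_] ∘ b ⟩ + t * quad ([_] ∘ c))) ≤ N * N →
           Good
  extend b c t ind disj 0≤t t≤1 sizes cost = (λ w → [ b w ] + t * [ c w ]) , record
    { lower  = λ w → 0≤+ 0≤[ b w ] (0≤* 0≤t 0≤[ c w ])
    ; upper  = up
    ; total  = trans (sum-linear t ([_] ∘ b) ([_] ∘ c)) sizes
    ; sparse = subst (λ q → (+ 25 / 1) * q ≤ N * N)
        (sym (trans (quad-+ t ([_] ∘ b) ([_] ∘ c))
          (trans (cong (_+ x) (quad-independent b ind)) (+-identityˡ x)))) cost }
    where
    x : ℚ
    x = t * (⟨ [_] ∘ c , [_] ∘ b ⟩ + ⟨ [_] ∘ c , [_] ∘ b ⟩ + t * quad ([_] ∘ c))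
    up : ∀ w → [ b w ] + t * [ c w ] ≤ 1ℚ
    up w with b w in bw | c w in cw
    ... | true  | true  = contradiction (trans (sym cw) (disj w bw)) λ ()
    ... | true  | false = ≤-reflexive (cong (_+_ 1ℚ) (*-zeroʳ t))
    ... | false | true  = ≤-trans (≤-reflexive (trans (+-identityˡ (t * 1ℚ)) (*-identityʳ t))) t≤1
    ... | false | false = ≤-trans (≤-reflexive (trans (+-identityˡ (t * 0ℚ)) (*-zeroʳ t))) 0≤1

  0<½N : 0ℚ < ½ * N
  0<½N = positive⁻¹ (½ * N) {{pos*pos⇒pos ½ N {{positive 0<n}}}}

  -- Scaled down to total weight N/2, the set `b` still spans no edges and costs nothing.
  large-independent : ∀ b → Independent b → ½ * N ≤ size b → Good
  large-independent b ind ½N≤b =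
    scale (fraction (½ * N) (size b) (<⇒≤ 0<½N) ½N≤b (<-≤-trans 0<½N ½N≤b))
    where
    -- `extend` starts from the empty set here, so that every vertex of `b` gets the same weight
    -- `t`.
    ∅ : Fin n → Bool
    ∅ _ = false
    m E : ℚ
    m = ⟨ [_] ∘ b , [_] ∘ ∅ ⟩
    E = quad ([_] ∘ b)
    m≡0 : m ≡ 0ℚ
    m≡0 = trans (⟨⟩-comm ([_] ∘ b) ([_] ∘ ∅)) (sum-zero _ λ u → *-zeroˡ (nbr ([_] ∘ b) u))
    cost≡0 : ∀ t → (+ 25 / 1) * (t * (m + m + t * E)) ≡ 0ℚ
    cost≡0 t = trans (cong₂ (λ m E → (+ 25 / 1) * (t * (m + m + t * E))) m≡0 (quad-independent b ind))
      (vanishing t)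
    scale : (∃ λ t → 0ℚ ≤ t × t ≤ 1ℚ × t * size b ≡ ½ * N) → Good
    scale (t , 0≤t , t≤1 , tb≡½N) = extend ∅ b t (λ _ _ ()) (λ _ ()) 0≤t t≤1
      (trans (cong (_+ t * size b) (sum-zero {n} (λ _ → 0ℚ) λ _ → refl))
        (trans (+-identityˡ (t * size b)) tb≡½N))
      (≤-trans (≤-reflexive (cost≡0 t)) (0≤* (<⇒≤ 0<n) (<⇒≤ 0<n)))

  -- Independent sets with fewer than half of the vertices.

  module Deficient (0<h : 0ℚ < h) where

    -- Weight h/|c| on each vertex of `c` completes `A` to a half. By the last hypothesis its cost
    -- is at most k times the added weight, which is kh.
    add-to-A : ∀ c → (∀ w → a w ≡ true → c w ≡ false) → h ≤ size c →
               quad ([_] ∘ c) + (⟨ [_] ∘ c , A ⟩ + ⟨ [_] ∘ c , A ⟩) ≤ k * size c → Good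
    add-to-A c disj h≤c sparse = scale (fraction h (size c) (<⇒≤ 0<h) h≤c (<-≤-trans 0<h h≤c))
      where
      0≤E : 0ℚ ≤ quad ([_] ∘ c)
      0≤E = ⟨⟩-nonneg ([_] ∘ c) ([_] ∘ c) (λ w → 0≤[ c w ]) (λ w → 0≤[ c w ])
      scale : (∃ λ t → 0ℚ ≤ t × t ≤ 1ℚ × t * size c ≡ h) → Good
      scale (t , 0≤t , t≤1 , tc≡h) = extend a c t a-ind disj 0≤t t≤1
        (trans (cong (_+_ k) tc≡h) (add-deficit N k))
        (join-cost N k t (size c) (quad ([_] ∘ c)) ⟨ [_] ∘ c , A ⟩ 0≤t t≤1 0≤E
          (subst (λ h′ → (+ 25 / 1) * (k * h′) ≤ N * N) (sym tc≡h) 25kh≤N²) sparse)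

    low : Fin n → Bool
    low w = f w + f w ≤?ᵇ k

    s b : Fin n → Bool
    s w = not (a w) ∧ low w
    b w = not (a w) ∧ not (low w)

    S B : Fin n → ℚ
    S w = [ s w ]
    B w = [ b w ]

    partition : ∀ w → A w + B w + S w ≡ 1ℚ
    partition w with a w | low w
    ... | true  | _     = refl
    ... | false | true  = refl
    ... | false | false = refl

    s-disjoint : ∀ w → a w ≡ true → s w ≡ false
    s-disjoint w aw = cong (λ x → not x ∧ low w) aw

    s⇒f+f≤k : ∀ w → s w ≡ true → f w + f w ≤ k
    s⇒f+f≤k w sw = ≤?ᵇ⇒≤ (∧-conicalʳ (not (a w)) (low w) sw)

    b⇒k<f+f : ∀ w → b w ≡ true → k < f w + f w
    b⇒k<f+f w bw = ≰?ᵇ⇒> (∧-conicalʳ (not (a w)) (not (low w)) bw)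

    adjacent⇒f+f≤k : ∀ u w → u ~ w → f u + f w ≤ k
    adjacent⇒f+f≤k u w u~w = subst (_≤ k) (∑-distrib-+ (λ x → adj u x * A x) (λ x → adj w x * A x))
      (sum-mono _ A λ x → term x (u ~? x) (w ~? x))
      where
      term : ∀ x (p : Dec (u ~ x)) (q : Dec (w ~ x)) → [ does p ] * A x + [ does q ] * A x ≤ A x
      term x (yes u~x) (yes w~x) = contradiction u~x (tf u w x u~w w~x)
      term x (yes _)   (no _)    = ≤-reflexive
        (trans (cong₂ _+_ (*-identityˡ (A x)) (*-zeroˡ (A x))) (+-identityʳ (A x)))
      term x (no _)    (yes _)   = ≤-reflexive
        (trans (cong₂ _+_ (*-zeroˡ (A x)) (*-identityˡ (A x))) (+-identityˡ (A x)))
      term x (no _)    (no _)    = ≤-trans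
        (≤-reflexive (cong₂ _+_ (*-zeroˡ (A x)) (*-zeroˡ (A x)))) 0≤[ a x ]

    b-ind : Independent b
    b-ind u w bu bw u~w = <-irrefl refl (<-≤-trans (+-mono-< (b⇒k<f+f u bu) (b⇒k<f+f w bw))
      (subst (_≤ k + k) (interchange (f u) (f w))
        (+-mono-≤ (adjacent⇒f+f≤k u w u~w) (adjacent⇒f+f≤k u w u~w))))

    -- The case |S| ≥ 2h.

    module LargeS (2h≤S : h + h ≤ size s) where

      p q : Fin n → Fin n → Bool
      p u w = s w ∧ does (u ~? w)
      q u w = s w ∧ not (does (u ~? w))

      P Q : Fin n → Fin n → ℚ
      P u w = [ p u w ]
      Q u w = [ q u w ]

      Q≡S-P : ∀ u w → Q u w ≡ S w + - 1ℚ * P u w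
      Q≡S-P u w = [∧not] (s w) (does (u ~? w))

      P≡adj*S : ∀ u w → adj u w * S w ≡ P u w
      P≡adj*S u w = trans (*-comm (adj u w) (S w)) (sym ([∧] (s w) (does (u ~? w))))

      p-disjoint : ∀ u w → a w ≡ true → p u w ≡ false
      p-disjoint u w aw = cong (_∧ does (u ~? w)) (s-disjoint w aw)

      q-disjoint : ∀ u w → a w ≡ true → q u w ≡ false
      q-disjoint u w aw = cong (_∧ not (does (u ~? w))) (s-disjoint w aw)

      p⇒~ : ∀ u w → p u w ≡ true → u ~ w
      p⇒~ u w puw = does⇒ (u ~? w) (∧-conicalʳ (s w) (does (u ~? w)) puw)

      p-ind : ∀ u → Independent (p u)
      p-ind u w w′ pw pw′ w~w′ = tf u w w′ (p⇒~ u w pw) w~w′ (p⇒~ u w′ pw′)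

      size-q : ∀ u → size (q u) ≡ size s + - 1ℚ * size (p u)
      size-q u = trans (sum-cong-≗ (Q≡S-P u)) (sum-linear (- 1ℚ) S (P u))

      ⟨Q,A⟩ : ∀ u → ⟨ Q u , A ⟩ ≡ ⟨ S , A ⟩ + - 1ℚ * ⟨ P u , A ⟩
      ⟨Q,A⟩ u = trans (⟨⟩-cong {y = A} (Q≡S-P u) (λ _ → refl)) (⟨⟩-linearˡ (- 1ℚ) S (P u) A)

      -- The factor `0ℚ` stands for `quad (P u)`, which vanishes because neighbours of `u` are
      -- pairwise non-adjacent.
      quad-Q : ∀ u → quad (Q u) ≡ quad S + - 1ℚ * (⟨ P u , S ⟩ + ⟨ P u , S ⟩ + - 1ℚ * 0ℚ)
      quad-Q u = trans (⟨⟩-cong (Q≡S-P u) (Q≡S-P u)) (trans (quad-+ (- 1ℚ) S (P u))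
        (cong (λ z → quad S + - 1ℚ * (⟨ P u , S ⟩ + ⟨ P u , S ⟩ + - 1ℚ * z))
          (quad-independent (p u) (p-ind u))))

      -- For `w` in `S`, the change of the slack in the last hypothesis of `add-to-A` when `w` alone
      -- is deleted from `S`. The slack of `S` itself is `c`.
      r : Fin n → ℚ
      r w = S w * ((nbr S w + nbr S w) + (f w + f w) - k)

      c : ℚ
      c = k * size s - (⟨ S , A ⟩ + ⟨ S , A ⟩) - quad S

      nbr-r : ∀ u → nbr r u ≡
        (⟨ P u , S ⟩ + ⟨ P u , S ⟩) + (⟨ P u , A ⟩ + ⟨ P u , A ⟩) + - k * size (p u)
      nbr-r u = trans (sum-cong-≗ term)
        (trans (sum-linear (- k) (λ w → (x w + x w) + (y w + y w)) (P u))
          (cong (_+ - k * size (p u))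
            (trans (∑-distrib-+ (λ w → x w + x w) (λ w → y w + y w))
              (cong₂ _+_ (∑-distrib-+ x x) (∑-distrib-+ y y)))))
        where
        x y : Fin n → ℚ
        x w = P u w * nbr S w
        y w = P u w * f w
        term : ∀ w → adj u w * r w ≡ ((x w + x w) + (y w + y w)) + - k * P u w
        term w = trans (sym (*-assoc (adj u w) (S w) z)) (trans (cong (_* z) (P≡adj*S u w))
          (slack-term (P u w) (nbr S w) (f w) k))
          where
          z : ℚ
          z = (nbr S w + nbr S w) + (f w + f w) - k

      -- The deleted vertices `P u` are pairwise non-adjacent, so their individual changes add up
      -- without a correction term.
      slack : ∀ u → c + nbr r u ≡ k * size (q u) - (quad (Q u) + (⟨ Q u , A ⟩ + ⟨ Q u , A ⟩))
      slack u = trans (cong (_+_ c) (nbr-r u)) (trans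
        (slack-regroup k (size s) ⟨ S , A ⟩ (quad S) (size (p u)) ⟨ P u , S ⟩ ⟨ P u , A ⟩)
        (sym (cong₂ (λ m z → k * m - z) (size-q u)
          (cong₂ (λ E F → E + (F + F)) (quad-Q u) (⟨Q,A⟩ u)))))

      -- By symmetry of the form, the sum of `nbr r` over `A` is the sum of `r w * f w`, while `c`
      -- is counted `k` times. Both are sums over `S`, and `slack-factor` factors their common
      -- summand.
      total-slack : sum (λ u → A u * (c + nbr r u)) ≡
                    sum (λ w → S w * ((k - (f w + f w)) * (k - (f w + nbr S w))))
      total-slack = trans
        (trans (sum-cong-≗ λ u → weigh (A u) c (nbr r u))
        (trans (sum-linear c (λ u → A u * nbr r u) A)
          (cong (_+ c * k) (⟨⟩-comm A r))))
        (sym (trans (sum-cong-≗ λ w → slack-factor (S w) (f w) (nbr S w) k)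
        (trans (sum-linear k (λ w → r w * f w)
          (λ w → - 1ℚ * (S w * f w + S w * f w + S w * nbr S w) + k * S w))
          (cong (_+_ ⟨ r , A ⟩) (trans (cong (k *_) sum-c) (*-comm k c))))))
        where
        sum-c : sum (λ w → - 1ℚ * (S w * f w + S w * f w + S w * nbr S w) + k * S w) ≡ c
        sum-c = trans (sum-linear k (λ w → - 1ℚ * (S w * f w + S w * f w + S w * nbr S w)) S)
          (trans (cong (_+ k * size s) (trans
            (sym (*-distribˡ-sum (- 1ℚ) (λ w → S w * f w + S w * f w + S w * nbr S w)))
            (cong (- 1ℚ *_) (trans (∑-distrib-+ (λ w → S w * f w + S w * f w) (λ w → S w * nbr S w))
              (cong (_+ quad S) (∑-distrib-+ (λ w → S w * f w) (λ w → S w * f w)))))))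
            (regroup k (size s) ⟨ S , A ⟩ (quad S)))

      -- `A` and `S` are disjoint, so the left side counts distinct neighbours of `w`.
      f+nbrS≤k : ∀ w → f w + nbr S w ≤ k
      f+nbrS≤k w = ≤-trans
        (subst (_≤ nbr (λ _ → 1ℚ) w) (∑-distrib-+ (λ x → adj w x * A x) (λ x → adj w x * S x))
          (sum-mono _ (λ x → adj w x * 1ℚ) λ x →
            ≤-by (adj w x * B x) (0≤* 0≤[ does (w ~? x) ] 0≤[ b x ])
            (trans (cong (adj w x *_) (sym (partition x)))
              (distribute (adj w x) (A x) (B x) (S x)))))
        (degree≤ w)

      0≤total-slack : 0ℚ ≤ sum (λ u → A u * (c + nbr r u))
      0≤total-slack = subst (0ℚ ≤_) (sym total-slack) (sum-nonneg _ λ w →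
        []*-nonneg (s w) λ sw → 0≤* (0≤gap (s⇒f+f≤k w sw)) (0≤gap (f+nbrS≤k w)))

      P-sparse : ∀ u → quad (P u) + (⟨ P u , A ⟩ + ⟨ P u , A ⟩) ≤ k * size (p u)
      P-sparse u = subst₂ _≤_
        (trans (trans (sum-cong-≗ λ w → *-distribˡ-+ (P u w) (f w) (f w))
            (∑-distrib-+ (λ w → P u w * f w) (λ w → P u w * f w)))
          (trans (sym (+-identityˡ (⟨ P u , A ⟩ + ⟨ P u , A ⟩)))
            (cong (_+ (⟨ P u , A ⟩ + ⟨ P u , A ⟩)) (sym (quad-independent (p u) (p-ind u))))))
        (trans (sum-cong-≗ λ w → *-comm (P u w) k) (sym (*-distribˡ-sum k (P u))))
        (sum-mono _ _ λ w → []*-mono (p u w) λ pw → s⇒f+f≤k w (∧-conicalˡ (s w) (does (u ~? w)) pw))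

      good : 0ℚ < k → Good
      good 0<k = conclude (some-nonneg a (λ u → c + nbr r u) 0<k 0≤total-slack)
        where
        conclude : (∃ λ u → a u ≡ true × 0ℚ ≤ c + nbr r u) → Good
        conclude (u , _ , 0≤slack) = choose (≤-total h (size (p u)))
          where
          choose : h ≤ size (p u) ⊎ size (p u) ≤ h → Good
          choose (inj₁ h≤p) = add-to-A (p u) (p-disjoint u) h≤p (P-sparse u)
          choose (inj₂ p≤h) = add-to-A (q u) (q-disjoint u)
            (subst (h ≤_) (sym (size-q u)) (remainder (size s) h (size (p u)) 2h≤S p≤h))
            (0≤gap⁻¹ (subst (0ℚ ≤_) (slack u) 0≤slack))

    -- The case |S| ≤ 2h.

    module SmallS (S≤2h : size s ≤ h + h) where

      partition-size : N ≡ k + size b + size s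
      partition-size = trans (sym (sum-ones n)) (trans (sum-cong-≗ (sym ∘ partition))
        (trans (∑-distrib-+ (λ w → A w + B w) S) (cong (_+ size s) (∑-distrib-+ A B))))

      -- `A`, `B` and `S` partition the vertices, so the left side is the sum of the degrees over
      -- `S`.
      degrees : ⟨ S , A ⟩ + ⟨ S , B ⟩ + quad S ≤ k * size s
      degrees = subst₂ _≤_
        (trans (sum-cong-≗ λ w → trans (*-distribˡ-+ (S w) (f w + nbr B w) (nbr S w))
            (cong (_+ S w * nbr S w) (*-distribˡ-+ (S w) (f w) (nbr B w))))
          (trans (∑-distrib-+ (λ w → S w * f w + S w * nbr B w) (λ w → S w * nbr S w))
            (cong (_+ quad S) (∑-distrib-+ (λ w → S w * f w) (λ w → S w * nbr B w)))))
        (trans (sum-cong-≗ λ w → *-comm (S w) k) (sym (*-distribˡ-sum k S)))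
        (sum-mono _ _ λ w → []*-mono (s w) λ _ → subst (_≤ k) (split w) (degree≤ w))
        where
        split : ∀ w → nbr (λ _ → 1ℚ) w ≡ f w + nbr B w + nbr S w
        split w = trans
          (sum-cong-≗ λ x → trans (cong (adj w x *_) (sym (partition x)))
            (trans (*-distribˡ-+ (adj w x) (A x + B x) (S x))
              (cong (_+ adj w x * S x) (*-distribˡ-+ (adj w x) (A x) (B x)))))
          (trans (∑-distrib-+ (λ x → adj w x * A x + adj w x * B x) (λ x → adj w x * S x))
            (cong (_+ nbr S w) (∑-distrib-+ (λ x → adj w x * A x) (λ x → adj w x * B x))))

      b-s-disjoint : ∀ w → b w ≡ true → s w ≡ false
      b-s-disjoint w = exclusive (not (a w)) (low w)

      interpolate : size b ≤ ½ * N → (∃ λ t → 0ℚ ≤ t × t ≤ 1ℚ × t * size s ≡ h) → Good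
      -- With ts = h, the bound |S| ≤ 2h becomes the hypothesis s ≤ 2ts of `mixed-cost`. A weighted
      -- mean of the two slacks is then non-negative, and hence so is one of them.
      interpolate b≤½N (t , 0≤t , t≤1 , ts≡h) = choose (one-nonneg t _ _ 0≤t t≤1
        (mixed-cost N k (size s) t (quad S) ⟨ S , A ⟩ ⟨ S , B ⟩ 0≤k
          (⟨⟩-nonneg S S (λ w → 0≤[ s w ]) (λ w → 0≤[ s w ])) 0≤t t≤1
          (subst (λ h′ → (+ 25 / 1) * (k * h′) ≤ N * N) (sym ts≡h) 25kh≤N²)
          degrees (subst (λ h′ → size s ≤ h′ + h′) (sym ts≡h) S≤2h)))
        where
        choose : _ ⊎ _ → Good
        choose (inj₁ cost≤) = extend a s t a-ind s-disjoint 0≤t t≤1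
          (trans (cong (_+_ k) ts≡h) (add-deficit N k)) (0≤gap⁻¹ cost≤)
        choose (inj₂ cost≤) = extend b s (1ℚ - t) b-ind b-s-disjoint (0≤gap t≤1) (1-t≤1 t 0≤t)
          (complement-size N k (size b) (size s) t partition-size ts≡h) (0≤gap⁻¹ cost≤)

      good : Good
      -- If |B| ≥ N/2, the independent set `B` suffices. Otherwise |S| = h + (N/2 - |B|) is at least
      -- h, which makes the weight h/|S| at most 1.
      good = choose (≤-total (½ * N) (size b))
        where
        choose : ½ * N ≤ size b ⊎ size b ≤ ½ * N → Good
        choose (inj₁ ½N≤b) = large-independent b b-ind ½N≤b
        choose (inj₂ b≤½N) = interpolate b≤½N (fraction h (size s) (<⇒≤ 0<h) h≤s (<-≤-trans 0<h h≤s))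
          where
          h≤s : h ≤ size s
          h≤s = ≤-by (½ * N - size b) (0≤gap b≤½N) (remaining N k (size b) (size s) partition-size)

    good : 0ℚ < k → Good
    good 0<k = choose (≤-total (h + h) (size s))
      where
      choose : h + h ≤ size s ⊎ size s ≤ h + h → Good
      choose (inj₁ 2h≤S) = LargeS.good 2h≤S 0<k
      choose (inj₂ S≤2h) = SmallS.good S≤2h

  0<k : 0ℚ < k
  0<k = ≰⇒> λ k≤0 → <-irrefl refl (<-≤-trans (*-monoʳ-<-pos (+ 2 / 1) 0<n)
    (≤-trans 2n≤5k (*-monoˡ-≤-nonNeg (+ 5 / 1) k≤0)))

  good : Good
  good = choose (½ * N ≤? k)
    where
    choose : Dec (½ * N ≤ k) → Good
    choose (yes ½N≤k) = large-independent a a-ind ½N≤k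
    choose (no ½N≰k)  = Deficient.good
      (subst (_< h) (+-inverseʳ k) (+-monoˡ-< (- k) (≰⇒> ½N≰k))) 0<k


-- The neighbourhood of a vertex of maximum degree.

mainTheorem10 : (n : ℕ) .{{_ : NonZero n}} (G : Graph n) → TriangleFree G →
    + 2 / 5 ≤ Δ G → β G ≤ᴿ fromℚ (+ 1 / 50)
mainTheorem10 n@(suc m) G tf 2/5≤Δ = sparse⇒β≤ (proj₁ half) (proj₂ half)
  where
  open Graph G
  open Edges G
  open Data.List.Extrema (DecTotalOrder.totalOrder ≤-decTotalOrder)

  degree : Fin n → ℚ
  degree = nbr (λ _ → 1ℚ)

  v : Fin n
  -- The default `zero` is itself a vertex, so the result has maximum degree.
  v = argmax degree zero (allFin n)

  a : Fin n → Bool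
  a w = does (v ~? w)

  degree≡size : ∀ u → degree u ≡ size (λ w → does (u ~? w))
  degree≡size u = sum-cong-≗ λ w → *-identityʳ (adj u w)

  degree≤ : ∀ u → degree u ≤ degree v
  degree≤ u = All.lookup (f[xs]≤f[argmax] {f = degree} zero (allFin n)) (∈-allFin u)

  0<n : 0ℚ < ι n
  0<n = subst (0ℚ <_) (sum-ones n) (+-mono-<-≤ (positive⁻¹ 1ℚ) (sum-nonneg {m} (λ _ → 1ℚ) λ _ → 0≤1))

  0≤1/n : 0ℚ ≤ + 1 / n
  0≤1/n = nonNegative⁻¹ (+ 1 / n) {{normalize-nonNeg 1 n}}

  relative : ∀ u → + ∣ neighbours u ∣ / n ≡ degree u * (+ 1 / n)
  relative u = trans
    (sym (trans (ι-*-/ ∣ neighbours u ∣ 1 n) (cong (λ d → + d / n) (ℕ.*-identityʳ ∣ neighbours u ∣))))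
    (cong (_* (+ 1 / n)) (trans (size-tabulate (λ w → does (u ~? w))) (sym (degree≡size u))))

  Δ≤ : Δ G ≤ degree v * (+ 1 / n)
  -- The first argument handles the base value 0 of the maximum that defines `Δ`.
  Δ≤ = max≤v⁺ (0≤* (nbr-nonneg (λ _ → 1ℚ) (λ _ → 0≤1) v) 0≤1/n)
    (All.map⁺ (All.universal (λ u → subst (_≤ degree v * (+ 1 / n)) (sym (relative u))
      (*-monoʳ-≤-nonNeg (+ 1 / n) {{nonNegative 0≤1/n}} (degree≤ u))) (allFin n)))

  2n≤5k : (+ 2 / 1) * ι n ≤ (+ 5 / 1) * size a
  2n≤5k = scale-up (ι n) (+ 1 / n) (size a) (<⇒≤ 0<n)
    (trans (ι-*-/ n 1 n) (trans (cong (λ d → + d / n) (ℕ.*-identityʳ n)) (n/n≡1 n)))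
    (subst (λ d → + 2 / 5 ≤ d * (+ 1 / n)) (degree≡size v) (≤-trans 2/5≤Δ Δ≤))

  half : ∃ SparseHalf
  half = LargeIndependentSet.good G tf 0<n a
    (λ u w au aw u~w → tf v u w (does⇒ (v ~? u) au) u~w (does⇒ (v ~? w) aw))
    (λ u → subst (degree u ≤_) (degree≡size v) (degree≤ u)) 2n≤5k
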